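{- For any $\epsilon > 0$ there is $n_0$ such that for every integer $n\ge n_0$ there is a tree $T$ of order $n$ (i.e. with $n$ vertices) such that $h(T) \ge (1/4 - \epsilon) \log_2(n)$.
   Context: The game: on a finite graph $G$, an invisible mouse and a team of $r$ cats ($r \ge 0$) play as follows. In round $i=1,2,\dots$ the mouse is at some vertex $v_i$, where $v_1$ is arbitrary and for $i\ge 2$ the vertex $v_i$ must be adjacent to $v_{i-1}$ (the mouse must move at every turn). Then each cat chooses any vertex of $G$ (cats are not constrained to move along edges); the mouse is caught in round $i$ if some cat chooses $v_i$. The cats never see the mouse, so a strategy for $r$ cats is a sequence $C_1,C_2,\dots$ of subsets of $V(G)$, each of size at most $r$, and the mouse evades it indefinitely if there is an infinite sequence of vertices $v_1,v_2,\dots$ with $v_i$ adjacent to $v_{i+1}$ and $v_i\notin C_i$ for all $i\ge 1$. The graph $G$ is an $r$-cat-win if some strategy for $r$ cats cannot be evaded indefinitely (equivalently, for finite $G$: there is a finite sequence $C_1,\dots,C_t$ of sets of size at most $r$ such that every walk $v_1,\dots,v_t$ in $G$ has $v_i\in C_i$ for some $i$); otherwise $G$ is an $r$-mouse-win. $h(G)$ denotes the least integer $r$ such that $G$ is an $r$-cat-win. -}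

module Defs where

open import Data.Fin using (Fin; toℕ; fromℕ; zero)
open import Data.Fin.Subset using (Subset; ∣_∣; _∈_)
import Data.Integer as ℤ
import Data.Integer.Properties as ℤ
open import Data.Nat as ℕ using (ℕ; zero; suc; z≤n; s≤s)
open import Data.Nat.Induction using (<-rec)
open import Data.Nat.Logarithm
  using (⌊log₂_⌋; ⌊log₂⌋-mono-≤; ⌊log₂[2^n]⌋≡n; ⌊log₂⌊n/2⌋⌋≡⌊log₂n⌋∸1)
import Data.Nat.Properties as ℕ
open import Data.Product using (∃-syntax; Σ-syntax; _×_; _,_)
open import Data.Rational as ℚ using (ℚ; 0ℚ; 1ℚ; mkℚ)
import Data.Rational.Properties as ℚ
open import Data.Rational.Solver using (module +-*-Solver)
import Data.Rational.Unnormalised as ℚᵘ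
import Data.Rational.Unnormalised.Properties as ℚᵘ
open import Data.Sum using (inj₁; inj₂)
open import Function.Definitions using (Injective)
open import Level using (0ℓ)
open import Relation.Binary.Construct.Closure.ReflexiveTransitive using (Star)
open import Relation.Binary.Core using (Rel)
open import Relation.Binary.Definitions using (Symmetric; Decidable)
open import Relation.Binary.PropositionalEquality
  using (_≡_; refl; sym; trans; cong; cong₂; subst; subst₂)
open import Relation.Nullary using (¬_; contradiction)

record Graph (n : ℕ) : Set₁ where
  infix 4 _∼_ _∼?_
  field
    _∼_      : Rel (Fin n) 0ℓ
    ∼-sym    : Symmetric _∼_
    ∼-irrefl : ∀ v → ¬ (v ∼ v)
    _∼?_     : Decidable _∼_

module _ {n : ℕ} (G : Graph n) where
  open Graph G

  IsWalk : ∀ {t} → (Fin t → Fin n) → Set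
  IsWalk v = ∀ {i j} → toℕ j ≡ suc (toℕ i) → v i ∼ v j

  -- A cycle of length 3 + m, listed from an arbitrary starting vertex.
  IsCycle : ∀ {m} → (Fin (3 ℕ.+ m) → Fin n) → Set
  IsCycle {m} c = Injective _≡_ _≡_ c × IsWalk c × c (fromℕ (2 ℕ.+ m)) ∼ c zero

  Connected : Set
  Connected = ∀ u v → Star _∼_ u v

  Acyclic : Set
  Acyclic = ∀ {m} (c : Fin (3 ℕ.+ m) → Fin n) → ¬ IsCycle c

  IsTree : Set
  IsTree = 0 ℕ.< n × Connected × Acyclic

  -- Round i + 1 of the game has index i : Fin t.  A walk has exactly t
  -- vertices, so a mouse with no legal move is caught, and t = 0 never
  -- works because the empty walk is not caught.
  CatWin : ℕ → Set
  CatWin r =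
    ∃[ t ] Σ[ C ∈ (Fin t → Subset n) ]
      (∀ i → ∣ C i ∣ ℕ.≤ r) ×
      (∀ (v : Fin t → Fin n) → IsWalk v → ∃[ i ] v i ∈ C i)

  -- h(G) = r: the least number of cats that wins on G.
  HasCatNumber : ℕ → Set
  HasCatNumber r = CatWin r × (∀ s → CatWin s → r ℕ.≤ s)

-- Real numbers as Cauchy sequences of rationals.  Equality of reals is
-- the induced equivalence, not _≡_, and the order relations below are
-- invariant under it.

IsCauchy : (ℕ → ℚ) → Set
IsCauchy x = ∀ δ → 0ℚ ℚ.< δ →
  ∃[ N ] ∀ j k → N ℕ.≤ j → N ℕ.≤ k → ℚ.∣ x j ℚ.- x k ∣ ℚ.≤ δ

record ℝ : Set where
  field
    seq    : ℕ → ℚ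
    cauchy : IsCauchy seq

open ℝ public

infix 4 _<ᵣ_ _≤ᵣ_

_<ᵣ_ : ℝ → ℝ → Set
x <ᵣ y = ∃[ δ ] 0ℚ ℚ.< δ × ∃[ N ] ∀ k → N ℕ.≤ k → seq x k ℚ.+ δ ℚ.≤ seq y k

_≤ᵣ_ : ℝ → ℝ → Set
x ≤ᵣ y = ∀ δ → 0ℚ ℚ.< δ → ∃[ N ] ∀ k → N ℕ.≤ k → seq x k ℚ.≤ seq y k ℚ.+ δ

fromℚ : ℚ → ℝ
fromℚ p = record
  { seq    = λ _ → p
  ; cauchy = λ δ 0<δ → 0 , λ _ _ _ _ →
      subst (ℚ._≤ δ) (sym (cong ℚ.∣_∣ (ℚ.+-inverseʳ p))) (ℚ.<⇒≤ 0<δ)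
  }

fromℕᵣ : ℕ → ℝ
fromℕᵣ m = fromℚ (ℤ.+ m ℚ./ 1)

private
  half-sum : ∀ δ → δ ℚ.* ℚ.½ ℚ.+ δ ℚ.* ℚ.½ ≡ δ
  half-sum δ = trans (sym (ℚ.*-distribˡ-+ δ ℚ.½ ℚ.½)) (ℚ.*-identityʳ δ)

  *-pos : ∀ {p q} → 0ℚ ℚ.< p → 0ℚ ℚ.< q → 0ℚ ℚ.< p ℚ.* q
  *-pos {p} {q} 0<p 0<q =
    subst (ℚ._< p ℚ.* q) (ℚ.*-zeroˡ q)
      (ℚ.*-monoˡ-<-pos q {{ℚ.positive 0<q}} 0<p)

  minus-cauchy : ∀ x y → IsCauchy (λ k → seq x k ℚ.- seq y k)
  minus-cauchy x y δ 0<δ =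
    let ε      = δ ℚ.* ℚ.½
        0<ε    = *-pos 0<δ (ℚ.positive⁻¹ ℚ.½)
        M , hx = cauchy x ε 0<ε
        N , hy = cauchy y ε 0<ε
    in M ℕ.⊔ N , λ j k j≥ k≥ →
      let a = seq x j ; b = seq y j ; c = seq x k ; d = seq y k in
      ℚ.≤-trans
        (ℚ.≤-trans
          (ℚ.≤-reflexive (cong ℚ.∣_∣ (rearrange a b c d)))
          (ℚ.∣p-q∣≤∣p∣+∣q∣ (a ℚ.- c) (b ℚ.- d)))
        (subst (ℚ.∣ a ℚ.- c ∣ ℚ.+ ℚ.∣ b ℚ.- d ∣ ℚ.≤_) (half-sum δ)
          (ℚ.+-mono-≤
            (hx j k (ℕ.m⊔n≤o⇒m≤o M N j≥) (ℕ.m⊔n≤o⇒m≤o M N k≥))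
            (hy j k (ℕ.m⊔n≤o⇒n≤o M N j≥) (ℕ.m⊔n≤o⇒n≤o M N k≥))))
    where
    open +-*-Solver
    rearrange : ∀ a b c d → (a ℚ.- b) ℚ.- (c ℚ.- d) ≡ (a ℚ.- c) ℚ.- (b ℚ.- d)
    rearrange = solve 4 (λ a b c d → (a :- b) :- (c :- d) := (a :- c) :- (b :- d)) refl

  eventually-bounded : ∀ x → ∃[ B ] 0ℚ ℚ.< B × ∃[ N ] ∀ k → N ℕ.≤ k → ℚ.∣ seq x k ∣ ℚ.≤ B
  eventually-bounded x with cauchy x 1ℚ (ℚ.positive⁻¹ 1ℚ)
  ... | N , h =
    1ℚ ℚ.+ ℚ.∣ seq x N ∣
    , subst (ℚ._< 1ℚ ℚ.+ ℚ.∣ seq x N ∣) (ℚ.+-identityʳ 0ℚ)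
        (ℚ.+-mono-<-≤ (ℚ.positive⁻¹ 1ℚ) (ℚ.0≤∣p∣ (seq x N)))
    , N , λ k k≥ →
        let a = seq x k ; b = seq x N in
        ℚ.≤-trans
          (ℚ.≤-trans
            (ℚ.≤-reflexive (cong ℚ.∣_∣ (split a b)))
            (ℚ.∣p+q∣≤∣p∣+∣q∣ (a ℚ.- b) b))
          (ℚ.+-monoˡ-≤ ℚ.∣ b ∣ (h k N k≥ ℕ.≤-refl))
    where
    open +-*-Solver
    split : ∀ a b → a ≡ (a ℚ.- b) ℚ.+ b
    split = solve 2 (λ a b → a := (a :- b) :+ b) refl

  *-mono-∣∣ : ∀ {p q B ε} → 0ℚ ℚ.< B → ℚ.∣ p ∣ ℚ.≤ B → ℚ.∣ q ∣ ℚ.≤ ε →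
              ℚ.∣ p ℚ.* q ∣ ℚ.≤ B ℚ.* ε
  *-mono-∣∣ {p} {q} {B} {ε} 0<B p≤ q≤ =
    ℚ.≤-trans (ℚ.≤-reflexive (ℚ.∣p*q∣≡∣p∣*∣q∣ p q))
      (ℚ.≤-trans
        (ℚ.*-monoʳ-≤-nonNeg ℚ.∣ q ∣ {{ℚ.∣-∣-nonNeg q}} p≤)
        (ℚ.*-monoˡ-≤-nonNeg B {{ℚ.nonNegative (ℚ.<⇒≤ 0<B)}} q≤))

  split-error : ∀ A B δ → 0ℚ ℚ.< A → 0ℚ ℚ.< B → 0ℚ ℚ.< δ →
                ∃[ ε ] 0ℚ ℚ.< ε × A ℚ.* ε ℚ.+ B ℚ.* ε ≡ δ
  split-error A B δ 0<A 0<B 0<δ =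
    1/C ℚ.* δ
    , *-pos (ℚ.positive⁻¹ 1/C {{ℚ.1/pos⇒pos C {{C-pos}}}}) 0<δ
    , trans (sym (ℚ.*-distribʳ-+ (1/C ℚ.* δ) A B))
        (trans (sym (ℚ.*-assoc C 1/C δ))
          (trans (cong (ℚ._* δ) (ℚ.*-inverseʳ C {{C-nonZero}})) (ℚ.*-identityˡ δ)))
    where
    C = A ℚ.+ B

    C-pos : ℚ.Positive C
    C-pos = ℚ.positive (subst (ℚ._< C) (ℚ.+-identityʳ 0ℚ) (ℚ.+-mono-< 0<A 0<B))

    C-nonZero : ℚ.NonZero C
    C-nonZero = ℚ.pos⇒nonZero C {{C-pos}}

    1/C = ℚ.1/_ C {{C-nonZero}}

  ∣ab-cd∣≤ : ∀ a b c d {A B ε δ} → 0ℚ ℚ.< A → 0ℚ ℚ.< B →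
    A ℚ.* ε ℚ.+ B ℚ.* ε ≡ δ →
    ℚ.∣ a ∣ ℚ.≤ A → ℚ.∣ d ∣ ℚ.≤ B →
    ℚ.∣ b ℚ.- d ∣ ℚ.≤ ε → ℚ.∣ a ℚ.- c ∣ ℚ.≤ ε →
    ℚ.∣ a ℚ.* b ℚ.- c ℚ.* d ∣ ℚ.≤ δ
  ∣ab-cd∣≤ a b c d {A} {B} {ε} {δ} 0<A 0<B total a≤ d≤ bd≤ ac≤ = begin
    ℚ.∣ a ℚ.* b ℚ.- c ℚ.* d ∣
      ≡⟨ cong ℚ.∣_∣ (rearrange a b c d) ⟩
    ℚ.∣ a ℚ.* (b ℚ.- d) ℚ.+ d ℚ.* (a ℚ.- c) ∣
      ≤⟨ ℚ.∣p+q∣≤∣p∣+∣q∣ (a ℚ.* (b ℚ.- d)) (d ℚ.* (a ℚ.- c)) ⟩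
    ℚ.∣ a ℚ.* (b ℚ.- d) ∣ ℚ.+ ℚ.∣ d ℚ.* (a ℚ.- c) ∣
      ≤⟨ ℚ.+-mono-≤ (*-mono-∣∣ {a} {b ℚ.- d} {A} {ε} 0<A a≤ bd≤)
                    (*-mono-∣∣ {d} {a ℚ.- c} {B} {ε} 0<B d≤ ac≤) ⟩
    A ℚ.* ε ℚ.+ B ℚ.* ε
      ≡⟨ total ⟩
    δ ∎
    where
    open ℚ.≤-Reasoning
    open +-*-Solver
    rearrange : ∀ a b c d →
      a ℚ.* b ℚ.- c ℚ.* d ≡ a ℚ.* (b ℚ.- d) ℚ.+ d ℚ.* (a ℚ.- c)
    rearrange = solve 4
      (λ a b c d → a :* b :- c :* d := a :* (b :- d) :+ d :* (a :- c)) refl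

  times-cauchy : ∀ x y → IsCauchy (λ k → seq x k ℚ.* seq y k)
  times-cauchy x y δ 0<δ =
    let A , 0<A , M , hA = eventually-bounded x
        B , 0<B , N , hB = eventually-bounded y
        ε , 0<ε , total  = split-error A B δ 0<A 0<B 0<δ
        P , hx           = cauchy x ε 0<ε
        Q , hy           = cauchy y ε 0<ε
    in (M ℕ.⊔ N) ℕ.⊔ (P ℕ.⊔ Q) , λ j k j≥ k≥ →
      let jMN = ℕ.m⊔n≤o⇒m≤o (M ℕ.⊔ N) (P ℕ.⊔ Q) j≥
          jPQ = ℕ.m⊔n≤o⇒n≤o (M ℕ.⊔ N) (P ℕ.⊔ Q) j≥
          kMN = ℕ.m⊔n≤o⇒m≤o (M ℕ.⊔ N) (P ℕ.⊔ Q) k≥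
          kPQ = ℕ.m⊔n≤o⇒n≤o (M ℕ.⊔ N) (P ℕ.⊔ Q) k≥
      in ∣ab-cd∣≤ (seq x j) (seq y j) (seq x k) (seq y k) 0<A 0<B total
           (hA j (ℕ.m⊔n≤o⇒m≤o M N jMN))
           (hB k (ℕ.m⊔n≤o⇒n≤o M N kMN))
           (hy j k (ℕ.m⊔n≤o⇒n≤o P Q jPQ) (ℕ.m⊔n≤o⇒n≤o P Q kPQ))
           (hx j k (ℕ.m⊔n≤o⇒m≤o P Q jPQ) (ℕ.m⊔n≤o⇒m≤o P Q kPQ))

infixl 6 _-ᵣ_
infixl 7 _*ᵣ_

_-ᵣ_ : ℝ → ℝ → ℝ
x -ᵣ y = record { seq = λ k → seq x k ℚ.- seq y k ; cauchy = minus-cauchy x y }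

_*ᵣ_ : ℝ → ℝ → ℝ
x *ᵣ y = record { seq = λ k → seq x k ℚ.* seq y k ; cauchy = times-cauchy x y }

-- With K = k + 1 and L = ⌊log₂ nᴷ⌋ we have 2ᴸ ≤ nᴷ < 2ᴸ⁺¹, that is,
-- L / K ≤ log₂ n < (L + 1) / K, for n ≥ 1.  For n = 0 the sequence is 0.
log₂-seq : ℕ → ℕ → ℚ
log₂-seq n k = ℤ.+ ⌊log₂ n ℕ.^ suc k ⌋ ℚ./ suc k

private
  2*⌊n/2⌋≤n : ∀ n → 2 ℕ.* ℕ.⌊ n /2⌋ ℕ.≤ n
  2*⌊n/2⌋≤n n = ℕ.≤-trans
    (ℕ.+-monoʳ-≤ ℕ.⌊ n /2⌋
      (ℕ.≤-trans (ℕ.≤-reflexive (ℕ.+-identityʳ _)) (ℕ.⌊n/2⌋≤⌈n/2⌉ n)))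
    (ℕ.≤-reflexive (ℕ.⌊n/2⌋+⌈n/2⌉≡n n))

  2^⌊log₂⌋≤ : ∀ n → 1 ℕ.≤ n → 2 ℕ.^ ⌊log₂ n ⌋ ℕ.≤ n
  2^⌊log₂⌋≤ = <-rec (λ n → 1 ℕ.≤ n → 2 ℕ.^ ⌊log₂ n ⌋ ℕ.≤ n) step
    where
    step : ∀ n → (∀ {m} → m ℕ.< n → 1 ℕ.≤ m → 2 ℕ.^ ⌊log₂ m ⌋ ℕ.≤ m) →
           1 ℕ.≤ n → 2 ℕ.^ ⌊log₂ n ⌋ ℕ.≤ n
    step (suc zero)    rec _ = ℕ.≤-refl
    step n@(suc (suc m)) rec _ =
      ℕ.≤-trans (ℕ.≤-reflexive (cong (2 ℕ.^_) log-half))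
        (ℕ.≤-trans
          (ℕ.*-monoʳ-≤ 2 (rec (ℕ.⌊n/2⌋<n (suc m)) (s≤s z≤n)))
          (2*⌊n/2⌋≤n n))
      where
      1≤log : 1 ℕ.≤ ⌊log₂ n ⌋
      1≤log = subst (ℕ._≤ ⌊log₂ n ⌋) (⌊log₂[2^n]⌋≡n 1)
                (⌊log₂⌋-mono-≤ {2} {n} (s≤s (s≤s z≤n)))
      log-half : ⌊log₂ n ⌋ ≡ suc ⌊log₂ ℕ.⌊ n /2⌋ ⌋
      log-half = trans (sym (ℕ.m+[n∸m]≡n 1≤log))
                   (cong suc (sym (⌊log₂⌊n/2⌋⌋≡⌊log₂n⌋∸1 n)))

  <2^1+⌊log₂⌋ : ∀ n → n ℕ.< 2 ℕ.^ suc ⌊log₂ n ⌋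
  <2^1+⌊log₂⌋ n = ℕ.≰⇒> λ p →
    ℕ.1+n≰n (subst (ℕ._≤ ⌊log₂ n ⌋) (⌊log₂[2^n]⌋≡n (suc ⌊log₂ n ⌋)) (⌊log₂⌋-mono-≤ p))

  cross : ∀ n → 1 ℕ.≤ n → ∀ a b →
    ⌊log₂ n ℕ.^ a ⌋ ℕ.* b ℕ.≤ suc ⌊log₂ n ℕ.^ b ⌋ ℕ.* a
  cross n 1≤n a b = ℕ.≮⇒≥ λ p →
    ℕ.<⇒≱ (ℕ.^-monoʳ-< 2 (s≤s (s≤s z≤n)) p) (begin
      2 ℕ.^ (⌊log₂ n ℕ.^ a ⌋ ℕ.* b)        ≡⟨ ℕ.^-*-assoc 2 ⌊log₂ n ℕ.^ a ⌋ b ⟨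
      (2 ℕ.^ ⌊log₂ n ℕ.^ a ⌋) ℕ.^ b        ≤⟨ ℕ.^-monoˡ-≤ b (2^⌊log₂⌋≤ (n ℕ.^ a) n^a≥1) ⟩
      (n ℕ.^ a) ℕ.^ b                      ≡⟨ ℕ.^-*-assoc n a b ⟩
      n ℕ.^ (a ℕ.* b)                      ≡⟨ cong (n ℕ.^_) (ℕ.*-comm a b) ⟩
      n ℕ.^ (b ℕ.* a)                      ≡⟨ ℕ.^-*-assoc n b a ⟨
      (n ℕ.^ b) ℕ.^ a                      ≤⟨ ℕ.^-monoˡ-≤ a (ℕ.<⇒≤ (<2^1+⌊log₂⌋ (n ℕ.^ b))) ⟩
      (2 ℕ.^ suc ⌊log₂ n ℕ.^ b ⌋) ℕ.^ a    ≡⟨ ℕ.^-*-assoc 2 (suc ⌊log₂ n ℕ.^ b ⌋) a ⟩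
      2 ℕ.^ (suc ⌊log₂ n ℕ.^ b ⌋ ℕ.* a)    ∎)
    where
    open ℕ.≤-Reasoning
    n^a≥1 : 1 ℕ.≤ n ℕ.^ a
    n^a≥1 = ℕ.m^n>0 n {{ℕ.>-nonZero 1≤n}} a

  /-mono : ∀ p q k l → p ℕ.* suc l ℕ.≤ q ℕ.* suc k → ℤ.+ p ℚ./ suc k ℚ.≤ ℤ.+ q ℚ./ suc l
  /-mono p q k l h = ℚ.toℚᵘ-cancel-≤
    (ℚᵘ.≤-trans (ℚᵘ.≤-reflexive (ℚ.toℚᵘ-fromℚᵘ (ℚᵘ.mkℚᵘ (ℤ.+ p) k)))
      (ℚᵘ.≤-trans (ℚᵘ.*≤* (subst₂ ℤ._≤_ (ℤ.pos-* p (suc l)) (ℤ.pos-* q (suc k)) (ℤ.+≤+ h)))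
        (ℚᵘ.≤-reflexive (ℚᵘ.≃-sym (ℚ.toℚᵘ-fromℚᵘ (ℚᵘ.mkℚᵘ (ℤ.+ q) l))))))

  /-suc : ∀ p k → ℤ.+ suc p ℚ./ suc k ≡ ℤ.+ p ℚ./ suc k ℚ.+ ℤ.+ 1 ℚ./ suc k
  /-suc p k = ℚ.toℚᵘ-injective
    (ℚᵘ.≃-trans (ℚ.toℚᵘ-fromℚᵘ (ℚᵘ.mkℚᵘ (ℤ.+ suc p) k))
      (ℚᵘ.≃-trans (ℚᵘ.*≡* eq)
        (ℚᵘ.≃-sym
          (ℚᵘ.≃-trans (ℚ.toℚᵘ-homo-+ (ℤ.+ p ℚ./ suc k) (ℤ.+ 1 ℚ./ suc k))
            (ℚᵘ.+-cong (ℚ.toℚᵘ-fromℚᵘ (ℚᵘ.mkℚᵘ (ℤ.+ p) k))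
                       (ℚ.toℚᵘ-fromℚᵘ (ℚᵘ.mkℚᵘ (ℤ.+ 1) k)))))))
    where
    K = ℤ.+ suc k
    eq : ℤ.+ suc p ℤ.* (K ℤ.* K) ≡ (ℤ.+ p ℤ.* K ℤ.+ ℤ.+ 1 ℤ.* K) ℤ.* K
    eq = trans (cong (ℤ._* (K ℤ.* K)) (cong ℤ.+_ (ℕ.+-comm 1 p)))
           (trans (sym (ℤ.*-assoc (ℤ.+ p ℤ.+ ℤ.+ 1) K K))
             (cong (ℤ._* K) (ℤ.*-distribʳ-+ K (ℤ.+ p) (ℤ.+ 1))))

  archimedean : ∀ δ → 0ℚ ℚ.< δ → ∃[ N ] ℤ.+ 1 ℚ./ suc N ℚ.≤ δ
  archimedean (mkℚ (ℤ.+ zero) d c) 0<δ = contradiction 0<δ λ { (ℚ.*<* (ℤ.+<+ ())) }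
  archimedean (mkℚ ℤ.-[1+ _ ] d c) 0<δ = contradiction 0<δ λ { (ℚ.*<* ()) }
  archimedean δ@(mkℚ (ℤ.+ suc m) d c) 0<δ = d ,
    subst (ℤ.+ 1 ℚ./ suc d ℚ.≤_) (ℚ.↥p/↧p≡p δ)
      (/-mono 1 (suc m) d d (ℕ.*-monoˡ-≤ (suc d) {1} {suc m} (s≤s z≤n)))

  ∣-∣-≤ : ∀ {x y δ} → x ℚ.≤ y ℚ.+ δ → y ℚ.≤ x ℚ.+ δ → ℚ.∣ x ℚ.- y ∣ ℚ.≤ δ
  ∣-∣-≤ {x} {y} {δ} p q with ℚ.∣p∣≡p∨∣p∣≡-p (x ℚ.- y)
  ... | inj₁ e = subst₂ ℚ._≤_ (sym e) (cancel y δ) (ℚ.+-monoˡ-≤ (ℚ.- y) p)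
    where
    open +-*-Solver
    cancel : ∀ y δ → (y ℚ.+ δ) ℚ.- y ≡ δ
    cancel = solve 2 (λ y δ → (y :+ δ) :- y := δ) refl
  ... | inj₂ e = subst₂ ℚ._≤_ (trans (flip x y) (sym e)) (cancel x δ) (ℚ.+-monoˡ-≤ (ℚ.- x) q)
    where
    open +-*-Solver
    cancel : ∀ y δ → (y ℚ.+ δ) ℚ.- y ≡ δ
    cancel = solve 2 (λ y δ → (y :+ δ) :- y := δ) refl
    flip : ∀ x y → y ℚ.- x ≡ ℚ.- (x ℚ.- y)
    flip = solve 2 (λ x y → y :- x := :- (x :- y)) refl

  log₂-seq-step : ∀ n → 1 ℕ.≤ n → ∀ {N} j k → N ℕ.≤ k →
    log₂-seq n j ℚ.≤ log₂-seq n k ℚ.+ ℤ.+ 1 ℚ./ suc N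
  log₂-seq-step n 1≤n {N} j k N≤k =
    ℚ.≤-trans (/-mono Lj (suc Lk) j k (cross n 1≤n (suc j) (suc k)))
      (ℚ.≤-trans (ℚ.≤-reflexive (/-suc Lk k))
        (ℚ.+-monoʳ-≤ (log₂-seq n k) (/-mono 1 1 k N (ℕ.*-monoʳ-≤ 1 (s≤s N≤k)))))
    where
    Lj = ⌊log₂ n ℕ.^ suc j ⌋
    Lk = ⌊log₂ n ℕ.^ suc k ⌋

  log₂-seq-zero : ∀ k → log₂-seq 0 k ≡ 0ℚ
  log₂-seq-zero k = ℚ.0/n≡0 (suc k)

  log₂-cauchy : ∀ n → IsCauchy (log₂-seq n)
  log₂-cauchy zero δ 0<δ = 0 , λ j k _ _ →
    subst (ℚ._≤ δ)
      (sym (cong₂ (λ p q → ℚ.∣ p ℚ.- q ∣) (log₂-seq-zero j) (log₂-seq-zero k)))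
      (ℚ.<⇒≤ 0<δ)
  log₂-cauchy n@(suc _) δ 0<δ with archimedean δ 0<δ
  ... | N , 1/N≤δ = N , λ j k N≤j N≤k →
    ℚ.≤-trans
      (∣-∣-≤ (log₂-seq-step n (s≤s z≤n) j k N≤k) (log₂-seq-step n (s≤s z≤n) k j N≤j))
      1/N≤δ

log₂ : ℕ → ℝ
log₂ n = record { seq = log₂-seq n ; cauchy = log₂-cauchy n }

-- Subdivide every edge of a complete binary tree.  The mouse's possible
-- positions alternate between the nodes and the midpoints ("stalks") of the
-- edges.  Measure them by degree, except that a branching node counts 2 instead
-- of 3, and that a set of stalks loses 1 at every node at which it has two or
-- three stalks.  A move of the mouse never lowers this potential and raises it by
-- at least the number ∂ of nodes whose three stalks are partly reached and partly
-- not, while a cat lowers it by at most 2.  So r cats are too few if some value M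
-- of the potential forces ∂ ≥ 2r just below M.  Each mixed node separates whole
-- subtrees, of potential 3·2ⁱ − 2, hence the potential is, up to O(∂), 3 times a
-- sum of about ∂ signed powers of two; it suffices to take M = 3·2^q·u with
-- u = 1 + 4 + ⋯ + 4^(k-1), which needs k signed powers of two.  In a tree of
-- about 2^(2k) vertices this forces 2r ≥ k up to a factor close to 1.
module Submission where

open import Defs
open import Data.Bool using (Bool; true; false; T)
open import Data.Fin as Fin using (Fin; zero; suc; fromℕ; inject₁)
import Data.Fin.Properties as Fin
open import Data.Fin.Relation.Unary.Top using (view; ‵fromℕ; ‵inject₁)
open import Data.Fin.Subset
  using (Subset; inside; outside; ∣_∣; _∈_; _∉_; _─_; ⊤; ⊥; Empty; Nonempty)
open import Data.Fin.Subset.Properties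
  using (_∈?_; ∈⊤; ∣⊥∣≡0; ∣⊤∣≡n; x∈p∧x∉q⇒x∈p─q; p─q⊆p; anySubset?; nonempty?)
import Data.Integer as ℤ
import Data.Integer.Properties as ℤ
open import Data.List as List using (List; length; filter)
open import Data.List.Membership.Propositional using () renaming (_∈_ to _∈ˡ_)
open import Data.List.Membership.Propositional.Properties
  using (∈-filter⁺; ∈-map⁺; ∈-++⁺ˡ; ∈-++⁺ʳ)
import Data.List.Properties as List
open import Data.List.Relation.Unary.Any as Any using (here; there)
open import Data.Maybe using (Maybe; just; nothing; maybe)
open import Data.Nat hiding (parity; _/_; _%_)
import Data.Nat as ℕ
open import Data.Nat.Binary using (ℕᵇ; zero; 1+[2_]; 2[1+_]; size)
import Data.Nat.Binary as ℕᵇ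
import Data.Nat.Binary.Properties as ℕᵇ
open import Data.Nat.Divisibility using (divides-refl)
open import Data.Nat.DivMod
  using ( m≡m%n+[m/n]*n; m%n<n; [m+kn]%n≡m%n; m<n⇒m%n≡m
        ; +-distrib-/-∣ʳ; m<n⇒m/n≡0; m*n/n≡m )
open import Data.Nat.Logarithm using (⌊log₂_⌋; ⌊log₂⌋-mono-≤; ⌊log₂[2^n]⌋≡n)
open import Data.Nat.Properties
open import Data.Nat.Tactic.RingSolver using (solve-∀)
open import Data.Product using (∃-syntax; Σ-syntax; _×_; _,_; proj₁; proj₂)
open import Data.Rational as ℚ using (ℚ; mkℚ; 0ℚ; _/_)
import Data.Rational.Properties as ℚ
open import Data.Rational.Solver using (module +-*-Solver)
import Data.Rational.Unnormalised as ℚᵘ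
import Data.Rational.Unnormalised.Properties as ℚᵘ
open import Data.Sum using (_⊎_; inj₁; inj₂; [_,_]′)
open import Data.Unit using (tt)
open import Data.Vec using ([]; _∷_; here; there; tabulate)
import Data.Vec.Properties as Vec
open import Function using (_∘_; id; case_of_)
open import Relation.Binary.Construct.Closure.ReflexiveTransitive as Star
  using (Star; _◅_; _◅◅_)
open import Relation.Binary.PropositionalEquality
open import Relation.Nullary using (¬_; Dec; yes; no; does; contradiction)
open import Relation.Nullary.Decidable using (map′; _×-dec_; _⊎-dec_; ¬?; dec-true)
open import Relation.Unary using (Decidable)

-- Trees given by a parent function

maximal-index : ∀ {n} (f : Fin (suc n) → ℕ) → ∃[ i ] ∀ j → f j ≤ f i
maximal-index {zero}  f = zero , λ { zero → ≤-refl }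
maximal-index {suc n} f with maximal-index (f ∘ suc)
... | i , max with ≤-total (f zero) (f (suc i))
...   | inj₁ f0≤ = suc i , λ { zero → f0≤ ; (suc j) → max j }
...   | inj₂ ≤f0 = zero  , λ { zero → ≤-refl ; (suc j) → ≤-trans (max j) ≤f0 }

module _ {n} (G : Graph n) where
  open Graph G

  -- A cycle is listed from an arbitrary start, so the first and the last position each take one of
  -- their two neighbours from the closing edge.
  cycle-neighbours : ∀ {m} (c : Fin (3 + m) → Fin n) → IsCycle G c →
    ∀ i → ∃[ j ] ∃[ k ] j ≢ k × c i ∼ c j × c i ∼ c k
  cycle-neighbours c (_ , walk , close) zero =
    suc zero , fromℕ _ , (λ ()) , walk refl , ∼-sym close
  cycle-neighbours {m} c (_ , walk , close) (suc i) with view i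
  ... | ‵fromℕ =
    inject₁ (fromℕ (suc m)) , zero , (λ ())
    , ∼-sym (walk (cong suc (sym (Fin.toℕ-inject₁ _)))) , close
  ... | ‵inject₁ i′ =
    inject₁ (inject₁ i′) , suc (suc i′)
    , (λ eq → <⇒≢ (m≤n⇒m≤1+n ≤-refl)
        (trans (sym (trans (Fin.toℕ-inject₁ _) (Fin.toℕ-inject₁ i′))) (cong Fin.toℕ eq)))
    , ∼-sym (walk (cong suc (sym (Fin.toℕ-inject₁ _))))
    , walk (cong (2 +_) (sym (Fin.toℕ-inject₁ i′)))

module ParentTree (p : ℕ → ℕ) (p≤ : ∀ i → p (suc i) ≤ i) where

  infix 4 _◁_

  -- The empty type `1 ≤ 0` leaves vertex 0 without a parent, whatever `p 0` is.
  _◁_ : ℕ → ℕ → Set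
  a ◁ zero  = 1 ≤ 0
  a ◁ suc i = a ≡ p (suc i)

  ◁⇒< : ∀ a b → a ◁ b → a < b
  ◁⇒< a (suc i) refl = s≤s (p≤ i)

  ◁-unique : ∀ a a′ b → a ◁ b → a′ ◁ b → a ≡ a′
  ◁-unique a a′ (suc i) refl refl = refl

  _◁?_ : ∀ a b → Dec (a ◁ b)
  a ◁? zero  = no λ ()
  a ◁? suc i = a ≟ p (suc i)

  -- Parents have smaller numbers, so every initial segment of the numbers is closed under parents:
  -- one parent function yields trees of all positive orders.
  parentTree : ∀ n → Graph n
  parentTree n = record
    { _∼_      = λ i j → Fin.toℕ i ◁ Fin.toℕ j ⊎ Fin.toℕ j ◁ Fin.toℕ i
    ; ∼-sym    = λ { (inj₁ e) → inj₂ e ; (inj₂ e) → inj₁ e }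
    ; ∼-irrefl = λ v → λ { (inj₁ e) → <-irrefl refl (◁⇒< _ _ e)
                         ; (inj₂ e) → <-irrefl refl (◁⇒< _ _ e) }
    ; _∼?_     = λ i j → (Fin.toℕ i ◁? Fin.toℕ j) ⊎-dec (Fin.toℕ j ◁? Fin.toℕ i)
    }

  module _ {n : ℕ} where
    open Graph (parentTree n)

    ∼∧≤⇒◁ : ∀ {i j} → i ∼ j → Fin.toℕ j ≤ Fin.toℕ i → Fin.toℕ j ◁ Fin.toℕ i
    ∼∧≤⇒◁ (inj₁ e) j≤i = contradiction (◁⇒< _ _ e) (≤⇒≯ j≤i)
    ∼∧≤⇒◁ (inj₂ e) j≤i = e

    -- The largest vertex of a cycle would have two parents.
    parentTree-acyclic : Acyclic (parentTree n)
    parentTree-acyclic c cyc@(inj , _) =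
      let i , max = maximal-index (Fin.toℕ ∘ c)
          j , k , j≢k , i∼j , i∼k = cycle-neighbours (parentTree n) c cyc i
      in j≢k (inj (Fin.toℕ-injective
           (◁-unique _ _ _ (∼∧≤⇒◁ i∼j (max j)) (∼∧≤⇒◁ i∼k (max k)))))

  module _ {n : ℕ} where
    open Graph (parentTree (suc n))

    to-root : ∀ b i → Fin.toℕ i < b → Star _∼_ i zero
    to-root (suc b) zero     _         = Star.ε
    to-root (suc b) (suc i) (s≤s i<b) = inj₂ parent ◅ to-root b j (<-≤-trans j<i i<b)
      where
      pi<n : p (suc (Fin.toℕ i)) < suc n
      pi<n = <-trans (s≤s (p≤ _)) (s≤s (Fin.toℕ<n i))
      j = Fin.fromℕ< pi<n
      parent : Fin.toℕ j ◁ suc (Fin.toℕ i)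
      parent = Fin.toℕ-fromℕ< pi<n
      j<i : Fin.toℕ j < suc (Fin.toℕ i)
      j<i = ◁⇒< _ _ parent

  parentTree-isTree : ∀ {n} → 0 < n → IsTree (parentTree n)
  parentTree-isTree {suc n} 0<n =
    0<n
    , (λ u v → to-root _ u ≤-refl ◅◅ Star.reverse (Graph.∼-sym (parentTree (suc n))) (to-root _ v ≤-refl))
    , parentTree-acyclic

-- Deciding which numbers of cats win

-- In an arbitrary chain growth could resume later; `Clear-bound` rules this out because each stage
-- of `Clear` is determined by the previous one.
record Stabilises {A : Set} (P : ℕ → A → Set) : Set where
  field
    bound  : ℕ
    stable : ∀ {a} → P (suc bound) a → P bound a

-- The list xs always contains the elements at which the chain may still grow.
chain-stabilises : ∀ {A : Set} {P : ℕ → A → Set} → (∀ t → Decidable (P t)) →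
  (∀ {t a} → P t a → P (suc t) a) →
  ∀ b t (xs : List A) → length xs < b → (∀ a → P t a ⊎ a ∈ˡ xs) → Stabilises P
chain-stabilises {A} {P} P? grow (suc b) t xs (s≤s len) cover with Any.any? (P? (suc t)) xs
... | yes new = chain-stabilises P? grow b (suc t) (filter (¬? ∘ P? (suc t)) xs)
                  (<-≤-trans (List.filter-notAll (¬? ∘ P? (suc t)) xs (Any.map (λ p ¬p → ¬p p) new)) len)
                  cover′
  where
  cover′ : ∀ a → P (suc t) a ⊎ a ∈ˡ filter (¬? ∘ P? (suc t)) xs
  cover′ a with cover a
  ... | inj₁ p = inj₁ (grow p)
  ... | inj₂ a∈ with P? (suc t) a
  ...   | yes p = inj₁ p
  ...   | no ¬p = inj₂ (∈-filter⁺ (¬? ∘ P? (suc t)) a∈ ¬p)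
... | no none = record
  { bound  = t
  ; stable = λ {a} p → [ id , (λ a∈ → contradiction (Any.map (λ { refl → p }) a∈) none) ]′ (cover a)
  }

subsets : ∀ n → List (Subset n)
subsets zero    = [] List.∷ List.[]
subsets (suc n) = List.map (outside ∷_) (subsets n) List.++ List.map (inside ∷_) (subsets n)

∈-subsets : ∀ {n} (S : Subset n) → S ∈ˡ subsets n
∈-subsets []            = here refl
∈-subsets (outside ∷ S) = ∈-++⁺ˡ (∈-map⁺ (outside ∷_) (∈-subsets S))
∈-subsets (inside  ∷ S) = ∈-++⁺ʳ _ (∈-map⁺ (inside ∷_) (∈-subsets S))

least : ∀ {P : ℕ → Set} → Decidable P → ∀ n → P n → ∃[ h ] P h × (∀ s → P s → h ≤ s)
least P? zero    p = 0 , p , λ _ _ → z≤n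
least P? (suc n) p with P? 0
... | yes p₀ = 0 , p₀ , λ _ _ → z≤n
... | no ¬p₀ with least (P? ∘ suc) n p
...   | h , ph , min = suc h , ph , λ { zero p₀ → contradiction p₀ ¬p₀ ; (suc s) ps → s≤s (min s ps) }

x∈p─q⇒x∉q : ∀ {n} {x : Fin n} (p q : Subset n) → x ∈ p ─ q → x ∉ q
x∈p─q⇒x∉q (_ ∷ p) (outside ∷ q) (there x∈) (there x∈q) = x∈p─q⇒x∉q p q x∈ x∈q
x∈p─q⇒x∉q (_ ∷ p) (inside ∷ q) (there x∈) (there x∈q) = x∈p─q⇒x∉q p q x∈ x∈q

module Territory {n} (G : Graph n) where
  open Graph G

  reachable? : (S : Subset n) → Decidable (λ j → ∃[ i ] i ∈ S × i ∼ j)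
  reachable? S j = Fin.any? λ i → (i ∈? S) ×-dec (i ∼? j)

  neighbours : Subset n → Subset n
  neighbours S = tabulate (λ j → does (reachable? S j))

  ∈-neighbours⁺ : ∀ {S i j} → i ∈ S → i ∼ j → j ∈ neighbours S
  ∈-neighbours⁺ {S} {i} {j} i∈S i∼j = Vec.lookup⇒[]= j _
    (trans (Vec.lookup∘tabulate _ j) (dec-true (reachable? S j) (i , i∈S , i∼j)))

  ∈-neighbours⁻ : ∀ {S j} → j ∈ neighbours S → ∃[ i ] i ∈ S × i ∼ j
  ∈-neighbours⁻ {S} {j} j∈ with reachable? S j | trans (sym (Vec.[]=⇒lookup j∈)) (Vec.lookup∘tabulate _ j)
  ... | yes r | _ = r

  infixr 5 _∷ʷ_
  _∷ʷ_ : ∀ {t} → Fin n → (Fin t → Fin n) → Fin (suc t) → Fin n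
  (u ∷ʷ v) zero    = u
  (u ∷ʷ v) (suc i) = v i

  ∷ʷ-isWalk : ∀ {t u} {v : Fin (suc t) → Fin n} → u ∼ v zero → IsWalk G v → IsWalk G (u ∷ʷ v)
  ∷ʷ-isWalk u∼ walk {zero}  {suc zero} _ = u∼
  ∷ʷ-isWalk u∼ walk {suc i} {suc j}    e = walk (suc-injective e)

  module _ (r : ℕ) where

    -- The mouse still moves after the t-th shot, so it may be cleared by having
    -- nowhere to go; this is why the strategy below lasts t + 1 rounds.
    Clear : ℕ → Subset n → Set
    Clear zero    S = Empty S
    Clear (suc t) S = ∃[ C ] ∣ C ∣ ≤ r × Clear t (neighbours (S ─ C))

    Clear? : ∀ t → Decidable (Clear t)
    Clear? zero    S = ¬? (nonempty? S)
    Clear? (suc t) S = anySubset? λ C → (∣ C ∣ ≤? r) ×-dec Clear? t (neighbours (S ─ C))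

    ∣⊥∣≤r : ∣ ⊥ {n} ∣ ≤ r
    ∣⊥∣≤r = subst (_≤ r) (sym (∣⊥∣≡0 n)) z≤n

    Clear-suc : ∀ t {S} → Clear t S → Clear (suc t) S
    Clear-suc zero    {S} empty = ⊥ , ∣⊥∣≤r , λ (j , j∈) →
      let i , i∈ , _ = ∈-neighbours⁻ j∈ in empty (i , p─q⊆p S ⊥ i∈)
    Clear-suc (suc t) (C , C≤ , clear) = C , C≤ , Clear-suc t clear

    strategy⇒Clear : ∀ t (C : Fin (suc t) → Subset n) → (∀ i → ∣ C i ∣ ≤ r) → ∀ S →
      (∀ v → IsWalk G v → v zero ∈ S → ∃[ i ] v i ∈ C i) → Clear (suc t) S
    strategy⇒Clear zero C C≤ S caught = C zero , C≤ zero , λ (j , j∈) →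
      let u , u∈ , _ = ∈-neighbours⁻ j∈
      in case caught (λ _ → u) (λ { {zero} {zero} () }) (p─q⊆p S (C zero) u∈) of
           λ { (zero , u∈C) → x∈p─q⇒x∉q S (C zero) u∈ u∈C }
    strategy⇒Clear (suc t) C C≤ S caught = C zero , C≤ zero ,
      strategy⇒Clear t (C ∘ suc) (C≤ ∘ suc) (neighbours (S ─ C zero)) λ v walk v₀∈ →
        let u , u∈ , u∼v₀ = ∈-neighbours⁻ v₀∈
        in case caught (u ∷ʷ v) (∷ʷ-isWalk u∼v₀ walk) (p─q⊆p S (C zero) u∈) of
             λ { (zero  , u∈C) → contradiction u∈C (x∈p─q⇒x∉q S (C zero) u∈)
               ; (suc i , v∈C) → i , v∈C }

    Clear⇒strategy : ∀ t S → Clear t S →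
      Σ[ C ∈ (Fin (suc t) → Subset n) ] (∀ i → ∣ C i ∣ ≤ r) ×
        (∀ v → IsWalk G v → v zero ∈ S → ∃[ i ] v i ∈ C i)
    Clear⇒strategy zero    S empty = (λ _ → ⊥) , (λ _ → ∣⊥∣≤r) , λ v _ v₀∈ → contradiction (v zero , v₀∈) empty
    Clear⇒strategy (suc t) S (C₀ , C₀≤ , clear) =
      let C , C≤ , caught = Clear⇒strategy t _ clear
      in (λ { zero → C₀ ; (suc i) → C i })
         , (λ { zero → C₀≤ ; (suc i) → C≤ i })
         , λ v walk v₀∈ → case v zero ∈? C₀ of λ where
             (yes v₀∈C₀) → zero , v₀∈C₀
             (no  v₀∉C₀) →
               let i , v∈C = caught (v ∘ suc) (λ e → walk (cong suc e))
                               (∈-neighbours⁺ (x∈p∧x∉q⇒x∈p─q v₀∈ v₀∉C₀) (walk refl))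
               in suc i , v∈C

    CatWin⇒Clear : CatWin G r → ∃[ t ] Clear t ⊤
    CatWin⇒Clear (zero  , _ , _  , caught) = case caught (λ ()) (λ { {()} }) of λ ()
    CatWin⇒Clear (suc t , C , C≤ , caught) = suc t , strategy⇒Clear t C C≤ ⊤ (λ v walk _ → caught v walk)

    Clear⇒CatWin : ∀ t → Clear t ⊤ → CatWin G r
    Clear⇒CatWin t clear =
      let C , C≤ , caught = Clear⇒strategy t ⊤ clear
      in suc t , C , C≤ , λ v walk → caught v walk ∈⊤

    Clear-stabilises : Stabilises Clear
    Clear-stabilises = chain-stabilises Clear? (λ {t} → Clear-suc t) _ 0 (subsets n) ≤-refl (λ S → inj₂ (∈-subsets S))

    open Stabilises Clear-stabilises

    Clear-+ : ∀ s t {S} → Clear t S → Clear (s + t) S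
    Clear-+ zero    t clear = clear
    Clear-+ (suc s) t clear = Clear-suc (s + t) (Clear-+ s t clear)

    Clear-bound : ∀ s {S} → Clear (s + bound) S → Clear bound S
    Clear-bound zero    clear = clear
    Clear-bound (suc s) (C , C≤ , clear) = stable (C , C≤ , Clear-bound s clear)

    -- The family of sets that can be cleared in t shots grows with t and is finite, so `bound`
    -- shots suffice whenever any number does. Decidability makes the least number of cats available
    -- constructively.
    CatWin? : Dec (CatWin G r)
    CatWin? = map′ (Clear⇒CatWin bound)
      (λ win → let t , clear = CatWin⇒Clear win
               in Clear-bound t (subst (λ s → Clear s ⊤) (+-comm bound t) (Clear-+ bound t clear)))
      (Clear? bound ⊤)

    -- The mouse wins by an invariant of the set of its possible positions; no evading walk has to
    -- be exhibited.
    survive : (Safe : Subset n → Set) → (∀ {S} → Safe S → Nonempty S) →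
      (∀ {S C} → ∣ C ∣ ≤ r → Safe S → Safe (neighbours (S ─ C))) → Safe ⊤ → ¬ CatWin G r
    survive Safe nonempty step safe win = let t , clear = CatWin⇒Clear win in go t safe clear
      where
      go : ∀ t {S} → Safe S → ¬ Clear t S
      go zero    safe empty            = empty (nonempty safe)
      go (suc t) safe (C , C≤ , clear) = go t (step C≤ safe) clear

  CatWin-n : CatWin G n
  CatWin-n = 1 , (λ _ → ⊤) , (λ _ → ≤-reflexive (∣⊤∣≡n n)) , λ _ _ → zero , ∈⊤

  catNumber : ∃[ h ] HasCatNumber G h
  catNumber = least CatWin? n CatWin-n

-- Potentials on the subdivided binary tree

bit : Bool → ℕ
bit false = 0
bit true  = 1

nae : Bool → Bool → Bool → ℕ
nae false false false = 0
nae true  true  true  = 0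
nae _     _     _     = 1

count : Bool → Bool → Bool → ℕ
count a b c = bit a + bit b + bit c

-- A heap address b : ℕᵇ is a path of left (1+[2_]) and right (2[1+_]) turns read
-- from the outside, so that a labelling is restricted to a subtree by composition.
left right : ∀ {A : Set} → (ℕᵇ → A) → ℕᵇ → A
left  f b = f 1+[2 b ]
right f b = f 2[1+ b ]

leftmost rightmost : ℕᵇ
leftmost  = 1+[2 zero ]
rightmost = 2[1+ zero ]

sum : ℕ → (ℕᵇ → ℕ) → ℕ
sum zero    f = f zero
sum (suc d) f = f zero + (sum d (left f) + sum d (right f))

-- Φₙ measures a set of nodes, Φₛ a set of stalks.  In Φₛ each stalk is shared
-- between its two ends, and s stalks at a branching node contribute
-- s minus the deduction, 0, 0, 1, 1 for s = 0, 1, 2, 3, that is ⌈s/2⌉.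
Φₙ : ℕ → (ℕᵇ → Bool) → ℕ
Φₙ zero    x = bit (x zero)
Φₙ (suc d) x = 2 * bit (x zero) + (Φₙ d (left x) + Φₙ d (right x))

branch mixed : (ℕᵇ → Bool) → ℕ
branch y = ⌈ count (y zero) (y leftmost) (y rightmost) /2⌉
mixed  y = nae (y zero) (y leftmost) (y rightmost)

Φₛ : ℕ → (ℕᵇ → Bool) → ℕ
Φₛ zero    y = bit (y zero)
Φₛ (suc d) y = branch y + (Φₛ d (left y) + Φₛ d (right y))

∂ : ℕ → (ℕᵇ → Bool) → ℕ
∂ zero    y = 0
∂ (suc d) y = mixed y + (∂ d (left y) + ∂ d (right y))

-- The potential of a completely reached subtree, the same for `Φₙ` and `Φₛ`.
full : ℕ → ℕ
full zero    = 1
full (suc d) = 2 + (full d + full d)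

2+full : ∀ d → 2 + full d ≡ 3 * 2 ^ d
2+full zero    = refl
2+full (suc d) = begin
  2 + (2 + (full d + full d))       ≡⟨ shuffle (full d) ⟩
  (2 + full d) + ((2 + full d) + 0) ≡⟨ cong₂ (λ a b → a + (b + 0)) (2+full d) (2+full d) ⟩
  2 * (3 * 2 ^ d)                   ≡⟨ swap (2 ^ d) ⟩
  3 * 2 ^ suc d                     ∎
  where
  open ≡-Reasoning
  shuffle : ∀ a → 2 + (2 + (a + a)) ≡ (2 + a) + ((2 + a) + 0)
  shuffle = solve-∀
  swap : ∀ a → 2 * (3 * a) ≡ 3 * (2 * a)
  swap = solve-∀

-- Children are appended at the innermost position.
graft : ℕᵇ → ℕᵇ → ℕᵇ
graft e zero     = e
graft e 1+[2 b ] = 1+[2 graft e b ]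
graft e 2[1+ b ] = 2[1+ graft e b ]

leftChild rightChild : ℕᵇ → ℕᵇ
leftChild  = graft leftmost
rightChild = graft rightmost

private
  variable
    d : ℕ
    x y : ℕᵇ → Bool

-- A node meets its own stalk and those of its two children; from any of these the mouse can step
-- onto it.
record StalksToNodes (d : ℕ) (y x : ℕᵇ → Bool) : Set where
  field
    same   : ∀ b → size b ≤ d → T (y b) → T (x b)
    fromˡ  : ∀ b → size b ≤ d → T (y (leftChild b)) → T (x b)
    fromʳ  : ∀ b → size b ≤ d → T (y (rightChild b)) → T (x b)

-- The strict bounds keep the stalks of the children within depth `d`.
record NodesToStalks (d : ℕ) (x y : ℕᵇ → Bool) : Set where
  field
    same : ∀ b → size b ≤ d → T (x b) → T (y b)
    toˡ  : ∀ b → size b < d → T (x b) → T (y (leftChild b))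
    toʳ  : ∀ b → size b < d → T (x b) → T (y (rightChild b))

StalksToNodes-left : StalksToNodes (suc d) y x → StalksToNodes d (left y) (left x)
StalksToNodes-left m = record
  { same  = λ b s → same 1+[2 b ] (s≤s s)
  ; fromˡ = λ b s → fromˡ 1+[2 b ] (s≤s s)
  ; fromʳ = λ b s → fromʳ 1+[2 b ] (s≤s s)
  }
  where open StalksToNodes m

StalksToNodes-right : StalksToNodes (suc d) y x → StalksToNodes d (right y) (right x)
StalksToNodes-right m = record
  { same  = λ b s → same 2[1+ b ] (s≤s s)
  ; fromˡ = λ b s → fromˡ 2[1+ b ] (s≤s s)
  ; fromʳ = λ b s → fromʳ 2[1+ b ] (s≤s s)
  }
  where open StalksToNodes m

NodesToStalks-left : NodesToStalks (suc d) x y → NodesToStalks d (left x) (left y)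
NodesToStalks-left m = record
  { same = λ b s → same 1+[2 b ] (s≤s s)
  ; toˡ  = λ b s → toˡ 1+[2 b ] (s≤s s)
  ; toʳ  = λ b s → toʳ 1+[2 b ] (s≤s s)
  }
  where open NodesToStalks m

NodesToStalks-right : NodesToStalks (suc d) x y → NodesToStalks d (right x) (right y)
NodesToStalks-right m = record
  { same = λ b s → same 2[1+ b ] (s≤s s)
  ; toˡ  = λ b s → toˡ 2[1+ b ] (s≤s s)
  ; toʳ  = λ b s → toʳ 2[1+ b ] (s≤s s)
  }
  where open NodesToStalks m

bit-mono : ∀ a b → (T a → T b) → bit a ≤ bit b
bit-mono false b     _ = z≤n
bit-mono true  false h = contradiction (h tt) id
bit-mono true  true  _ = ≤-refl

-- Three stalks count 0 or 2 if they agree and 1 if they are mixed. A mixed triple thus gains 1 when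
-- the node between them is entered and, in `node-gain`, when it arises around an unreached node.
stalk-gain : ∀ a b c → ⌈ count a b c /2⌉ + nae a b c ≤ 2
stalk-gain false false false = z≤n
stalk-gain false false true  = ≤-refl
stalk-gain false true  false = ≤-refl
stalk-gain false true  true  = ≤-refl
stalk-gain true  false false = ≤-refl
stalk-gain true  false true  = ≤-refl
stalk-gain true  true  false = ≤-refl
stalk-gain true  true  true  = ≤-refl

node-gain : ∀ a b c → nae a b c ≤ ⌈ count a b c /2⌉
node-gain false false false = z≤n
node-gain false false true  = ≤-refl
node-gain false true  false = ≤-refl
node-gain false true  true  = ≤-refl
node-gain true  false false = ≤-refl
node-gain true  false true  = ≤-refl
node-gain true  true  false = ≤-refl
node-gain true  true  true  = z≤n

+-interchange₃ : ∀ a b c a′ b′ c′ → (a + (b + c)) + (a′ + (b′ + c′)) ≡ (a + a′) + ((b + b′) + (c + c′))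
+-interchange₃ = solve-∀

-- Both sides are sums over the nodes, so one node at a time suffices; a leaf counts only its own
-- stalk and has no term in `∂`.
Φₛ+∂≤Φₙ : ∀ d {x y} → StalksToNodes d y x → Φₛ d y + ∂ d y ≤ Φₙ d x
Φₛ+∂≤Φₙ zero m =
  ≤-trans (≤-reflexive (+-identityʳ _)) (bit-mono _ _ (StalksToNodes.same m zero z≤n))
Φₛ+∂≤Φₙ (suc d) {x} {y} m =
  ≤-trans (≤-reflexive (+-interchange₃ (branch y) (Φₛ d (left y)) (Φₛ d (right y))
                          (mixed y) (∂ d (left y)) (∂ d (right y))))
    (+-mono-≤ (local (x zero) (y zero) (y leftmost) (y rightmost)
                     (same zero z≤n) (fromˡ zero z≤n) (fromʳ zero z≤n))
      (+-mono-≤ (Φₛ+∂≤Φₙ d (StalksToNodes-left m)) (Φₛ+∂≤Φₙ d (StalksToNodes-right m))))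
  where
  open StalksToNodes m
  local : ∀ v a b c → (T a → T v) → (T b → T v) → (T c → T v) →
          ⌈ count a b c /2⌉ + nae a b c ≤ 2 * bit v
  local true  a     b     c     _ _ _ = stalk-gain a b c
  local false false false false _ _ _ = z≤n
  local false true  _     _     h _ _ = contradiction (h tt) id
  local false false true  _     _ h _ = contradiction (h tt) id
  local false false false true  _ _ h = contradiction (h tt) id

Φₙ+∂≤Φₛ : ∀ d {x y} → NodesToStalks d x y → Φₙ d x + ∂ d y ≤ Φₛ d y
Φₙ+∂≤Φₛ zero m =
  ≤-trans (≤-reflexive (+-identityʳ _)) (bit-mono _ _ (NodesToStalks.same m zero z≤n))
Φₙ+∂≤Φₛ (suc d) {x} {y} m =
  ≤-trans (≤-reflexive (+-interchange₃ (2 * bit (x zero)) (Φₙ d (left x)) (Φₙ d (right x))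
                          (mixed y) (∂ d (left y)) (∂ d (right y))))
    (+-mono-≤ (local (x zero) (y zero) (y leftmost) (y rightmost)
                     (same zero z≤n) (toˡ zero (s≤s z≤n)) (toʳ zero (s≤s z≤n)))
      (+-mono-≤ (Φₙ+∂≤Φₛ d (NodesToStalks-left m)) (Φₙ+∂≤Φₛ d (NodesToStalks-right m))))
  where
  open NodesToStalks m
  local : ∀ v a b c → (T v → T a) → (T v → T b) → (T v → T c) →
          2 * bit v + nae a b c ≤ ⌈ count a b c /2⌉
  local false a     b     c     _ _ _ = node-gain a b c
  local true  true  true  true  _ _ _ = ≤-refl
  local true  false _     _     h _ _ = contradiction (h tt) id
  local true  true  false _     _ h _ = contradiction (h tt) id
  local true  true  true  false _ _ h = contradiction (h tt) id

Φₙ-loss : ∀ d {x x′ : ℕᵇ → Bool} (c : ℕᵇ → ℕ) → (∀ b → bit (x b) ≤ bit (x′ b) + c b) →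
  Φₙ d x ≤ Φₙ d x′ + 2 * sum d c
Φₙ-loss zero {x′ = x′} c h = ≤-trans (h zero) (+-monoʳ-≤ (bit (x′ zero)) (m≤m+n (c zero) _))
Φₙ-loss (suc d) {x} {x′} c h = ≤-trans
  (+-mono-≤ (*-monoʳ-≤ 2 (h zero))
    (+-mono-≤ (Φₙ-loss d (left c) (λ b → h 1+[2 b ])) (Φₙ-loss d (right c) (λ b → h 2[1+ b ]))))
  (≤-reflexive (rearrange (bit (x′ zero)) (c zero)
    (Φₙ d (left x′)) (sum d (left c)) (Φₙ d (right x′)) (sum d (right c))))
  where
  rearrange : ∀ a c l sl r sr →
    2 * (a + c) + ((l + 2 * sl) + (r + 2 * sr)) ≡ (2 * a + (l + r)) + 2 * (c + (sl + sr))
  rearrange = solve-∀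

⌈[m+n]/2⌉≤⌈m/2⌉+n : ∀ m n → ⌈ m + n /2⌉ ≤ ⌈ m /2⌉ + n
⌈[m+n]/2⌉≤⌈m/2⌉+n m zero    = ≤-reflexive (trans (cong ⌈_/2⌉ (+-identityʳ m)) (sym (+-identityʳ _)))
⌈[m+n]/2⌉≤⌈m/2⌉+n m (suc n) = begin
  ⌈ m + suc n /2⌉    ≡⟨ cong ⌈_/2⌉ (+-suc m n) ⟩
  suc ⌊ m + n /2⌋    ≤⟨ s≤s (⌊n/2⌋≤⌈n/2⌉ (m + n)) ⟩
  suc ⌈ m + n /2⌉    ≤⟨ s≤s (⌈[m+n]/2⌉≤⌈m/2⌉+n m n) ⟩
  suc (⌈ m /2⌉ + n)  ≡⟨ +-suc ⌈ m /2⌉ n ⟨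
  ⌈ m /2⌉ + suc n    ∎
  where open ≤-Reasoning

-- The root stalk meets one node of the subtree and so has weight 1 only;
-- its missing half is what the extra summand c zero pays for.
Φₛ-loss : ∀ d {y y′ : ℕᵇ → Bool} (c : ℕᵇ → ℕ) → (∀ b → bit (y b) ≤ bit (y′ b) + c b) →
  Φₛ d y + c zero ≤ Φₛ d y′ + 2 * sum d c
Φₛ-loss zero {y} {y′} c h = ≤-trans (+-monoˡ-≤ (c zero) (h zero)) (≤-reflexive (rearrange (bit (y′ zero)) (c zero)))
  where
  rearrange : ∀ a c → (a + c) + c ≡ a + 2 * c
  rearrange = solve-∀
Φₛ-loss (suc d) {y} {y′} c h = begin
  branch y + (Φₛ d (left y) + Φₛ d (right y)) + c zero
    ≤⟨ +-monoˡ-≤ (c zero) (+-monoˡ-≤ _ local) ⟩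
  branch y′ + (c zero + c leftmost + c rightmost)
    + (Φₛ d (left y) + Φₛ d (right y)) + c zero
    ≡⟨ split (branch y′) (c zero) (c leftmost) (c rightmost) (Φₛ d (left y)) (Φₛ d (right y)) ⟩
  branch y′ + 2 * c zero
    + ((Φₛ d (left y) + c leftmost) + (Φₛ d (right y) + c rightmost))
    ≤⟨ +-monoʳ-≤ (branch y′ + 2 * c zero)
         (+-mono-≤ (Φₛ-loss d (left c) (λ b → h 1+[2 b ])) (Φₛ-loss d (right c) (λ b → h 2[1+ b ]))) ⟩
  branch y′ + 2 * c zero
    + ((Φₛ d (left y′) + 2 * sum d (left c)) + (Φₛ d (right y′) + 2 * sum d (right c)))
    ≡⟨ rearrange (branch y′) (c zero)
         (Φₛ d (left y′)) (sum d (left c)) (Φₛ d (right y′)) (sum d (right c)) ⟩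
  Φₛ (suc d) y′ + 2 * sum (suc d) c ∎
  where
  open ≤-Reasoning
  group : ∀ a b c a′ b′ c′ → (a + a′) + (b + b′) + (c + c′) ≡ (a + b + c) + (a′ + b′ + c′)
  group = solve-∀
  local : branch y
          ≤ branch y′ + (c zero + c leftmost + c rightmost)
  local = ≤-trans
    (⌈n/2⌉-mono (≤-trans (+-mono-≤ (+-mono-≤ (h zero) (h leftmost)) (h rightmost))
      (≤-reflexive (group (bit (y′ zero)) (bit (y′ leftmost)) (bit (y′ rightmost)) (c zero) (c leftmost) (c rightmost)))))
    (⌈[m+n]/2⌉≤⌈m/2⌉+n (count (y′ zero) (y′ leftmost) (y′ rightmost)) _)
  split : ∀ k a b c l r → k + (a + b + c) + (l + r) + a ≡ k + 2 * a + ((l + b) + (r + c))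
  split = solve-∀
  rearrange : ∀ k a l sl r sr → k + 2 * a + ((l + 2 * sl) + (r + 2 * sr)) ≡ (k + (l + r)) + 2 * (a + (sl + sr))
  rearrange = solve-∀

Φₙ-full : ∀ d {x} → (∀ b → size b ≤ d → T (x b)) → full d ≤ Φₙ d x
Φₙ-full zero    {x} h = bit-mono true (x zero) (λ _ → h zero z≤n)
Φₙ-full (suc d) {x} h = +-mono-≤ (*-monoʳ-≤ 2 (bit-mono true (x zero) (λ _ → h zero z≤n)))
  (+-mono-≤ (Φₙ-full d (λ b s → h 1+[2 b ] (s≤s s))) (Φₙ-full d (λ b s → h 2[1+ b ] (s≤s s))))

Φₙ-support : ∀ d {x} → 0 < Φₙ d x → ∃[ b ] T (x b)
Φₙ-support zero {x} pos with x zero in eq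
... | true = zero , subst T (sym eq) tt
Φₙ-support (suc d) {x} pos with x zero in eq
... | true = zero , subst T (sym eq) tt
... | false with Φₙ d (left x) in eqˡ
...   | suc _ = let b , xb = Φₙ-support d (subst (0 <_) (sym eqˡ) (s≤s z≤n)) in 1+[2 b ] , xb
...   | zero  = let b , xb = Φₙ-support d pos in 2[1+ b ] , xb

Φₛ-support : ∀ d {y} → 0 < Φₛ d y → ∃[ b ] T (y b)
Φₛ-support zero {y} pos with y zero in eq
... | true = zero , subst T (sym eq) tt
Φₛ-support (suc d) {y} pos with y zero in eq | y leftmost in eqˡ | y rightmost in eqʳ
... | true  | _     | _     = zero , subst T (sym eq) tt
... | false | true  | _     = leftmost , subst T (sym eqˡ) tt
... | false | false | true  = rightmost , subst T (sym eqʳ) tt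
... | false | false | false with Φₛ d (left y) in eq′
...   | suc _ = let b , yb = Φₛ-support d (subst (0 <_) (sym eq′) (s≤s z≤n)) in 1+[2 b ] , yb
...   | zero  = let b , yb = Φₛ-support d pos in 2[1+ b ] , yb

-- Weights of signed binary expansions

lastBit : ℕ → ℕ
lastBit zero          = 0
lastBit (suc zero)    = 1
lastBit (suc (suc u)) = lastBit u

-- The least number of signed powers of two that sum to u modulo 2 ^ k.
weight : ℕ → ℕ → ℕ
weight zero    u = 0
weight (suc k) u = lastBit u + weight k ⌊ u /2⌋ ⊓ weight k ⌈ u /2⌉

lastBit-double : ∀ h → lastBit (h + h) ≡ 0
lastBit-double zero    = refl
lastBit-double (suc h) = trans (cong (lastBit ∘ suc) (+-suc h h)) (lastBit-double h)

lastBit-1+double : ∀ h → lastBit (suc (h + h)) ≡ 1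
lastBit-1+double zero    = refl
lastBit-1+double (suc h) = trans (cong lastBit (+-suc h h)) (lastBit-1+double h)

weight-double : ∀ k h → weight (suc k) (h + h) ≡ weight k h
weight-double k h = begin
  lastBit (h + h) + weight k ⌊ h + h /2⌋ ⊓ weight k ⌈ h + h /2⌉
    ≡⟨ cong₂ _+_ (lastBit-double h)
         (sym (cong₂ (λ a b → weight k a ⊓ weight k b) (n≡⌊n+n/2⌋ h) (n≡⌈n+n/2⌉ h))) ⟩
  weight k h ⊓ weight k h
    ≡⟨ ⊓-idem _ ⟩
  weight k h ∎
  where open ≡-Reasoning

weight-1+double : ∀ k h → weight (suc k) (suc (h + h)) ≡ suc (weight k h ⊓ weight k (suc h))
weight-1+double k h = cong₂ _+_ (lastBit-1+double h)
  (sym (cong₂ (λ a b → weight k a ⊓ weight k b) (n≡⌈n+n/2⌉ h) (cong suc (n≡⌊n+n/2⌋ h))))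

data Halves : ℕ → Set where
  even : ∀ h → Halves (h + h)
  odd  : ∀ h → Halves (suc (h + h))

halve : ∀ u → Halves u
halve zero = even 0
halve (suc u) with halve u
... | even h = odd h
... | odd h  = subst Halves (cong suc (+-suc h h)) (even (suc h))

Near : ℕ → ℕ → Set
Near a b = a ≤ suc b × b ≤ suc a

Near-⊓ : ∀ {a b c d} → Near a c → Near b d → Near (a ⊓ b) (c ⊓ d)
Near-⊓ (ac , ca) (bd , db) = ⊓-mono-≤ ac bd , ⊓-mono-≤ ca db

-- Of two consecutive numbers one is odd, and its weight is 1 plus the smaller weight of its two
-- rounded halves. These are consecutive, so the induction hypothesis compares them.
weight-suc : ∀ k u → Near (weight k u) (weight k (suc u))
weight-suc zero    u = z≤n , z≤n
weight-suc (suc k) u with halve u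
... | even h = subst₂ Near (sym (weight-double k h)) (sym (weight-1+double k h))
  ( m≤n⇒m≤1+n (⊓-glb (n≤1+n _) (proj₁ (weight-suc k h)))
  , s≤s (m⊓n≤m _ _))
... | odd h = subst₂ Near (sym (weight-1+double k h))
  (sym (trans (cong (weight (suc k) ∘ suc) (sym (+-suc h h))) (weight-double k (suc h))))
  ( s≤s (m⊓n≤n _ _)
  , m≤n⇒m≤1+n (⊓-glb (proj₂ (weight-suc k h)) (n≤1+n _)))

double-+ : ∀ h p → (h + h) + 2 * p ≡ (h + p) + (h + p)
double-+ = solve-∀

-- Adding 2^(i+1) keeps the last bit and adds 2^i to both rounded halves, which reduces everything
-- to adding 1.
weight-+2^ : ∀ k i u → Near (weight k u) (weight k (u + 2 ^ i))
weight-+2^ zero    i       u = z≤n , z≤n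
weight-+2^ (suc k) zero    u rewrite +-comm u 1 = weight-suc (suc k) u
weight-+2^ (suc k) (suc i) u with halve u
... | even h = subst₂ Near (sym (weight-double k h))
  (sym (trans (cong (weight (suc k)) (double-+ h (2 ^ i))) (weight-double k (h + 2 ^ i))))
  (weight-+2^ k i h)
... | odd h = subst₂ Near (sym (weight-1+double k h))
  (sym (trans (cong (weight (suc k) ∘ suc) (double-+ h (2 ^ i))) (weight-1+double k (h + 2 ^ i))))
  (let a , b = Near-⊓ (weight-+2^ k i h) (weight-+2^ k i (suc h)) in s≤s a , s≤s b)

weight-0 : ∀ k → weight k 0 ≡ 0
weight-0 zero    = refl
weight-0 (suc k) = trans (⊓-idem (weight k 0)) (weight-0 k)

-- The number 1 + 4 + ⋯ + 4^(k-1): no two of its binary ones are adjacent, so negative terms never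
-- shorten the sum.
heavy : ℕ → ℕ
heavy zero    = 0
heavy (suc k) = suc (4 * heavy k)

-- The rounded halves of 4u + 1 are 2u and 2u + 1. The first weighs as much as u and the second no
-- less, so each step adds exactly 1.
weight-heavy : ∀ k → weight (k + k) (heavy k) ≡ k
weight-heavy zero    = refl
weight-heavy (suc k) = begin
  weight (suc (k + suc k)) (suc (4 * u))
    ≡⟨ cong₂ weight (cong suc (+-suc k k)) (cong suc (4* u)) ⟩
  weight (2 + (k + k)) (suc (2u + 2u))
    ≡⟨ weight-1+double (suc (k + k)) 2u ⟩
  suc (weight (suc (k + k)) 2u ⊓ weight (suc (k + k)) (suc 2u))
    ≡⟨ cong suc (cong₂ _⊓_ (weight-double (k + k) u) (weight-1+double (k + k) u)) ⟩
  suc (weight (k + k) u ⊓ suc (weight (k + k) u ⊓ weight (k + k) (suc u)))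
    ≡⟨ cong suc (m≤n⇒m⊓n≡m (⊓-glb (n≤1+n _) (proj₁ (weight-suc (k + k) u)))) ⟩
  suc (weight (k + k) u)
    ≡⟨ cong suc (weight-heavy k) ⟩
  suc k ∎
  where
  open ≡-Reasoning
  u  = heavy k
  2u = u + u
  4* : ∀ u → 4 * u ≡ (u + u) + (u + u)
  4* = solve-∀

-- The edge-isoperimetric inequality

Near⇒∣-∣≤1 : ∀ {a b} → Near a b → ∣ a - b ∣ ≤ 1
Near⇒∣-∣≤1 {a} {b} (a≤ , b≤) with ∣m-n∣≡[m∸n]∨[n∸m] a b
... | inj₁ eq = ≤-trans (≤-reflexive eq) (m≤n+o⇒m∸n≤o a b (≤-trans a≤ (≤-reflexive (+-comm 1 b))))
... | inj₂ eq = ≤-trans (≤-reflexive eq) (m≤n+o⇒m∸n≤o b a (≤-trans b≤ (≤-reflexive (+-comm 1 a))))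

∣-∣-+-≤ : ∀ a b c d → ∣ a + b - c + d ∣ ≤ ∣ a - c ∣ + ∣ b - d ∣
∣-∣-+-≤ a b c d = begin
  ∣ a + b - c + d ∣                      ≤⟨ ∣-∣-triangle (a + b) (c + b) (c + d) ⟩
  ∣ a + b - c + b ∣ + ∣ c + b - c + d ∣  ≡⟨ cong₂ _+_ shift (∣m+n-m+o∣≡∣n-o∣ c b d) ⟩
  ∣ a - c ∣ + ∣ b - d ∣                  ∎
  where
  open ≤-Reasoning
  shift : ∣ a + b - c + b ∣ ≡ ∣ a - c ∣
  shift = trans (cong₂ ∣_-_∣ (+-comm a b) (+-comm c b)) (∣m+n-m+o∣≡∣n-o∣ b a c)

module Gauge (k q : ℕ) where

  -- The grid width. A larger `q` makes constant errors negligible against `Q`, at the price of `q`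
  -- further levels of the tree.
  Q : ℕ
  Q = 3 * 2 ^ q

  instance
    2^q≢0 : NonZero (2 ^ q)
    2^q≢0 = m^n≢0 2 q

    Q≢0 : NonZero Q
    Q≢0 = m*n≢0 3 (2 ^ q)

  -- Linear interpolation of Q * weight k u at the multiples u * Q: moving by 1
  -- costs at most 1, moving by the size 3 * 2 ^ i of a subtree at most Q.
  gauge : ℕ → ℕ
  gauge z = (Q ∸ z ℕ.% Q) * weight k (z ℕ./ Q) + z ℕ.% Q * weight k (suc (z ℕ./ Q))

  gauge-< : ∀ s u → s < Q → gauge (s + u * Q) ≡ (Q ∸ s) * weight k u + s * weight k (suc u)
  gauge-< s u s<Q = cong₂ (λ m v → (Q ∸ m) * weight k v + m * weight k (suc v))
    (trans ([m+kn]%n≡m%n s u Q) (m<n⇒m%n≡m s<Q))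
    (trans (+-distrib-/-∣ʳ s (divides-refl u))
      (cong₂ _+_ (m<n⇒m/n≡0 s<Q) (m*n/n≡m u Q)))

  gauge-* : ∀ u → gauge (u * Q) ≡ Q * weight k u
  gauge-* u = trans (gauge-< 0 u (>-nonZero⁻¹ Q)) (+-identityʳ _)

  -- The right end `s = Q` is included so that both ends of a unit step obey the same linear
  -- formula.
  gauge-≤ : ∀ s u → s ≤ Q → gauge (s + u * Q) ≡ (Q ∸ s) * weight k u + s * weight k (suc u)
  gauge-≤ s u s≤Q with m≤n⇒m<n∨m≡n s≤Q
  ... | inj₁ s<Q  = gauge-< s u s<Q
  ... | inj₂ refl = trans (gauge-* (suc u))
    (cong (λ m → m * weight k u + Q * weight k (suc u)) (sym (n∸n≡0 Q)))

  gauge-suc : ∀ z → ∣ gauge (suc z) - gauge z ∣ ≤ 1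
  gauge-suc z = begin
    ∣ gauge (suc z) - gauge z ∣
      ≡⟨ cong (λ z → ∣ gauge (suc z) - gauge z ∣) (m≡m%n+[m/n]*n z Q) ⟩
    ∣ gauge (suc s + u * Q) - gauge (s + u * Q) ∣
      ≡⟨ cong₂ ∣_-_∣ (gauge-≤ (suc s) u s<Q) (gauge-≤ s u (<⇒≤ s<Q)) ⟩
    ∣ (Q ∸ suc s) * a + suc s * b - (Q ∸ s) * a + s * b ∣
      ≡⟨ cong (λ m → ∣ (Q ∸ suc s) * a + suc s * b - m * a + s * b ∣) (sym (+-∸-assoc 1 s<Q)) ⟨
    ∣ t * a + suc s * b - suc t * a + s * b ∣
      ≡⟨ cong₂ ∣_-_∣ (common t s a b) (common′ t s a b) ⟩
    ∣ t * a + s * b + b - t * a + s * b + a ∣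
      ≡⟨ ∣m+n-m+o∣≡∣n-o∣ (t * a + s * b) b a ⟩
    ∣ b - a ∣
      ≡⟨ ∣-∣-comm b a ⟩
    ∣ a - b ∣
      ≤⟨ Near⇒∣-∣≤1 (weight-suc k u) ⟩
    1 ∎
    where
    open ≤-Reasoning
    s = z ℕ.% Q
    u = z ℕ./ Q
    t = Q ∸ suc s
    a = weight k u
    b = weight k (suc u)
    s<Q = m%n<n z Q
    common : ∀ t s a b → t * a + suc s * b ≡ t * a + s * b + b
    common = solve-∀
    common′ : ∀ t s a b → suc t * a + s * b ≡ t * a + s * b + a
    common′ = solve-∀

  gap : ℕ → ℕ → ℕ
  gap m n = ∣ gauge m - gauge n ∣

  gap-refl : ∀ m {k} → gap m m ≤ k
  gap-refl m = ≤-trans (≤-reflexive (∣n-n∣≡0 (gauge m))) z≤n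

  gap-sym : ∀ m n {k} → gap m n ≤ k → gap n m ≤ k
  gap-sym m n = ≤-trans (≤-reflexive (∣-∣-comm (gauge n) (gauge m)))

  gap-trans : ∀ l m n {j k} → gap l m ≤ j → gap m n ≤ k → gap l n ≤ j + k
  gap-trans l m n lm mn = ≤-trans (∣-∣-triangle (gauge l) (gauge m) (gauge n)) (+-mono-≤ lm mn)

  gap-+ : ∀ e z → gap (z + e) z ≤ e
  gap-+ zero    z rewrite +-identityʳ z = gap-refl z
  gap-+ (suc e) z rewrite +-suc z e = gap-trans (suc (z + e)) (z + e) z (gauge-suc (z + e)) (gap-+ e z)

  -- A shift by a multiple of `Q` keeps the position `s` within the grid cell. The weights at both
  -- ends of the cell change by at most 1, and their coefficients `Q ∸ s` and `s` add up to `Q`.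
  gap-2^* : ∀ i z → gap (z + 2 ^ i * Q) z ≤ Q
  gap-2^* i z = begin
    ∣ gauge (z + v * Q) - gauge z ∣
      ≡⟨ cong (λ z → ∣ gauge (z + v * Q) - gauge z ∣) (m≡m%n+[m/n]*n z Q) ⟩
    ∣ gauge (s + u * Q + v * Q) - gauge (s + u * Q) ∣
      ≡⟨ cong (λ y → ∣ gauge y - gauge (s + u * Q) ∣)
           (trans (+-assoc s (u * Q) (v * Q)) (cong (s +_) (sym (*-distribʳ-+ Q u v)))) ⟩
    ∣ gauge (s + (u + v) * Q) - gauge (s + u * Q) ∣
      ≡⟨ cong₂ ∣_-_∣ (gauge-< s (u + v) s<Q) (gauge-< s u s<Q) ⟩
    ∣ (Q ∸ s) * weight k (u + v) + s * weight k (suc (u + v)) - (Q ∸ s) * weight k u + s * weight k (suc u) ∣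
      ≤⟨ ∣-∣-+-≤ ((Q ∸ s) * weight k (u + v)) _ ((Q ∸ s) * weight k u) _ ⟩
    ∣ (Q ∸ s) * weight k (u + v) - (Q ∸ s) * weight k u ∣ + ∣ s * weight k (suc (u + v)) - s * weight k (suc u) ∣
      ≤⟨ +-mono-≤ (scaled (Q ∸ s) u) (scaled s (suc u)) ⟩
    (Q ∸ s) + s
      ≡⟨ m∸n+n≡m (<⇒≤ s<Q) ⟩
    Q ∎
    where
    open ≤-Reasoning
    s = z ℕ.% Q
    u = z ℕ./ Q
    v = 2 ^ i
    s<Q = m%n<n z Q
    scaled : ∀ m u → ∣ m * weight k (u + v) - m * weight k u ∣ ≤ m
    scaled m u = begin
      ∣ m * weight k (u + v) - m * weight k u ∣  ≡⟨ *-distribˡ-∣-∣ m _ _ ⟨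
      m * ∣ weight k (u + v) - weight k u ∣      ≡⟨ cong (m *_) (∣-∣-comm (weight k (u + v)) _) ⟩
      m * ∣ weight k u - weight k (u + v) ∣      ≤⟨ *-monoʳ-≤ m (Near⇒∣-∣≤1 (weight-+2^ k i u)) ⟩
      m * 1                                      ≡⟨ *-identityʳ m ⟩
      m                                          ∎

  -- Shifts with i ≤ q are no longer than `Q`, and slope at most 1 suffices; the others are
  -- multiples of `Q` by a power of two.
  gap-3*2^ : ∀ i z → gap (z + 3 * 2 ^ i) z ≤ Q
  gap-3*2^ i z with ≤-total i q
  ... | inj₁ i≤q = ≤-trans (gap-+ (3 * 2 ^ i) z) (*-monoʳ-≤ 3 (^-monoʳ-≤ 2 i≤q))
  ... | inj₂ q≤i = subst (λ m → gap (z + m) z ≤ Q) eq (gap-2^* (i ∸ q) z)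
    where
    rearrange : ∀ a b → a * (3 * b) ≡ 3 * (b * a)
    rearrange = solve-∀
    eq : 2 ^ (i ∸ q) * Q ≡ 3 * 2 ^ i
    eq = trans (rearrange (2 ^ (i ∸ q)) (2 ^ q))
      (cong (3 *_) (trans (sym (^-distribˡ-+-* 2 q (i ∸ q))) (cong (2 ^_) (m+[n∸m]≡n q≤i))))

  -- The shifts used below fall short of some 3·2ⁱ by 1, 2 or 3, and each missing unit costs at most
  -- 1.
  K : ℕ
  K = Q + 3

  gap-almost : ∀ i m e z → m + e ≡ 3 * 2 ^ i → e ≤ 3 → gap (z + m) z ≤ K
  gap-almost i m e z m+e≡ e≤3 = begin
    gap (z + m) z
      ≤⟨ gap-trans (z + m) (z + (m + e)) z
           (gap-sym (z + (m + e)) (z + m) (subst (λ y → gap y (z + m) ≤ e) (+-assoc z m e) (gap-+ e (z + m))))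
           (subst (λ n → gap (z + n) z ≤ Q) (sym m+e≡) (gap-3*2^ i z)) ⟩
    e + Q  ≤⟨ +-monoˡ-≤ Q e≤3 ⟩
    3 + Q  ≡⟨ +-comm 3 Q ⟩
    K      ∎
    where open ≤-Reasoning

  gap-full : ∀ d z → gap (z + full d) z ≤ K
  gap-full d z = gap-almost d (full d) 2 z (trans (+-comm (full d) 2) (2+full d)) (s≤s (s≤s z≤n))

  gap-1+full : ∀ d z → gap (z + suc (full d)) z ≤ K
  gap-1+full d z = gap-almost d (suc (full d)) 1 z (trans (+-comm (suc (full d)) 1) (2+full d)) (s≤s z≤n)

  gap-1+2full : ∀ d z → gap (z + suc (full d + full d)) z ≤ K
  gap-1+2full d z = gap-almost (suc d) (suc (full d + full d)) 3 z
    (trans (+-comm (suc (full d + full d)) 3) (2+full (suc d))) ≤-refl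

  above : ∀ {δ m n} → (∀ z → gap (z + δ) z ≤ K) → n + δ ≡ m → gap m n ≤ K * 1
  above {n = n} h refl = ≤-trans (h n) (≤-reflexive (sym (*-identityʳ K)))

  below : ∀ {δ m n} → (∀ z → gap (z + δ) z ≤ K) → m + δ ≡ n → gap m n ≤ K * 1
  below {m = m} {n} h eq = gap-sym n m (above h eq)

  -- Two uniform subtrees and their branching node are replaced by one subtree that is uniform like
  -- the stalk above it. The potential is unchanged if the three stalks agree; otherwise it shifts
  -- by f + 1 or 2f + 1, where f is `full d`.
  gap-branch : ∀ d a b c z →
    gap (z + (⌈ count a b c /2⌉ + (bit b * full d + bit c * full d))) (z + bit a * full (suc d)) ≤ K * nae a b c
  gap-branch d false false false z = gap-refl (z + 0)
  gap-branch d true  true  true  z =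
    subst (λ n → gap (z + (2 + ((full d + 0) + (full d + 0)))) (z + n) ≤ K * 0) (eq (full d))
      (gap-refl (z + (2 + ((full d + 0) + (full d + 0)))))
    where
    eq : ∀ f → 2 + ((f + 0) + (f + 0)) ≡ 2 + (f + f) + 0
    eq = solve-∀
  gap-branch d false false true  z = above (gap-1+full d) (eq z (full d))
    where
    eq : ∀ z f → z + 0 + suc f ≡ z + (1 + (0 + (f + 0)))
    eq = solve-∀
  gap-branch d false true  false z = above (gap-1+full d) (eq z (full d))
    where
    eq : ∀ z f → z + 0 + suc f ≡ z + (1 + ((f + 0) + 0))
    eq = solve-∀
  gap-branch d false true  true  z = above (gap-1+2full d) (eq z (full d))
    where
    eq : ∀ z f → z + 0 + suc (f + f) ≡ z + (1 + ((f + 0) + (f + 0)))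
    eq = solve-∀
  gap-branch d true  false false z = below (gap-1+2full d) (eq z (full d))
    where
    eq : ∀ z f → z + (1 + (0 + 0)) + suc (f + f) ≡ z + ((2 + (f + f)) + 0)
    eq = solve-∀
  gap-branch d true  false true  z = below (gap-1+full d) (eq z (full d))
    where
    eq : ∀ z f → z + (1 + (0 + (f + 0))) + suc f ≡ z + ((2 + (f + f)) + 0)
    eq = solve-∀
  gap-branch d true  true  false z = below (gap-1+full d) (eq z (full d))
    where
    eq : ∀ z f → z + (1 + ((f + 0) + 0)) + suc f ≡ z + ((2 + (f + f)) + 0)
    eq = solve-∀

  -- Subtrees are made uniform from the leaves upwards, at cost `K` for each mixed node. The gauge
  -- is not additive, so the offset `z` carries the potential of the rest of the tree.
  isoperimetry : ∀ d y z → gap (z + Φₛ d y) (z + bit (y zero) * full d) ≤ K * ∂ d y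
  isoperimetry zero y z = subst (λ m → gap (z + bit (y zero)) (z + m) ≤ K * 0)
    (sym (*-identityʳ (bit (y zero)))) (gap-refl (z + bit (y zero)))
  isoperimetry (suc d) y z = begin
    gap (z + (B + (L + R))) (z + bit (y zero) * full (suc d))
      ≤⟨ gap-trans (z + (B + (L + R))) (z + (B + (l + R))) (z + bit (y zero) * full (suc d)) stepˡ
           (gap-trans (z + (B + (l + R))) (z + (B + (l + r))) (z + bit (y zero) * full (suc d)) stepʳ
             (gap-branch d (y zero) (y leftmost) (y rightmost) z)) ⟩
    K * ∂ d (left y) + (K * ∂ d (right y) + K * mixed y)
      ≡⟨ collect K (∂ d (left y)) (∂ d (right y)) (mixed y) ⟩
    K * ∂ (suc d) y ∎
    where
    open ≤-Reasoning
    B = branch y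
    L = Φₛ d (left y)
    R = Φₛ d (right y)
    l = bit (y leftmost) * full d
    r = bit (y rightmost) * full d
    collect : ∀ k a b c → k * a + (k * b + k * c) ≡ k * (c + (a + b))
    collect = solve-∀
    moveˡ : ∀ z b l r → (z + (b + r)) + l ≡ z + (b + (l + r))
    moveˡ = solve-∀
    moveʳ : ∀ z b l r → (z + (b + l)) + r ≡ z + (b + (l + r))
    moveʳ = solve-∀
    stepˡ : gap (z + (B + (L + R))) (z + (B + (l + R))) ≤ K * ∂ d (left y)
    stepˡ = subst₂ (λ m n → gap m n ≤ K * ∂ d (left y)) (moveˡ z B L R) (moveˡ z B l R)
      (isoperimetry d (left y) (z + (B + R)))
    stepʳ : gap (z + (B + (l + R))) (z + (B + (l + r))) ≤ K * ∂ d (right y)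
    stepʳ = subst₂ (λ m n → gap m n ≤ K * ∂ d (right y)) (moveʳ z B l R) (moveʳ z B l r)
      (isoperimetry d (right y) (z + (B + l)))

-- The tree

-- The innermost turn is dropped; `nothing` marks the root.
addressParent : ℕᵇ → Maybe ℕᵇ
addressParent zero     = nothing
addressParent 1+[2 b ] = just (maybe 1+[2_] zero (addressParent b))
addressParent 2[1+ b ] = just (maybe 2[1+_] zero (addressParent b))

addressParent-graft : ∀ {e} → addressParent e ≡ just zero → ∀ b → addressParent (graft e b) ≡ just b
addressParent-graft e-child zero     = e-child
addressParent-graft e-child 1+[2 b ] = cong (just ∘ maybe 1+[2_] zero) (addressParent-graft e-child b)
addressParent-graft e-child 2[1+ b ] = cong (just ∘ maybe 2[1+_] zero) (addressParent-graft e-child b)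

addressParent-< : ∀ b {c} → addressParent b ≡ just c → ℕᵇ.toℕ c < ℕᵇ.toℕ b
addressParent-< 1+[2 b ] refl with addressParent b in eq
... | nothing = s≤s z≤n
... | just c  = s≤s (*-monoʳ-< 2 (addressParent-< b eq))
addressParent-< 2[1+ b ] refl with addressParent b in eq
... | nothing = s≤s z≤n
... | just c  = *-monoʳ-< 2 (s≤s (addressParent-< b eq))

-- The heap address b has a stalk 1+[2 b ] and, below it, a node 2[1+ b ].
-- The stalk hangs from the node of the parent address; the stalk of the root
-- address hangs from the additional vertex 0.
parent : ℕᵇ → ℕᵇ
parent zero     = zero
parent 1+[2 b ] = maybe 2[1+_] zero (addressParent b)
parent 2[1+ b ] = 1+[2 b ]

parent-≤ : ∀ a → ℕᵇ.toℕ (parent a) ≤ pred (ℕᵇ.toℕ a)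
parent-≤ zero     = z≤n
parent-≤ 1+[2 b ] with addressParent b in eq
... | nothing = z≤n
... | just c  = *-monoʳ-≤ 2 (addressParent-< b eq)
parent-≤ 2[1+ b ] = ≤-reflexive (sym (+-suc (ℕᵇ.toℕ b) (ℕᵇ.toℕ b + 0)))

open ParentTree (ℕᵇ.toℕ ∘ parent ∘ ℕᵇ.fromℕ)
  (λ i → ≤-trans (parent-≤ (ℕᵇ.fromℕ (suc i))) (≤-reflexive (cong pred (ℕᵇ.toℕ-fromℕ (suc i)))))

heapTree : ∀ n → Graph n
heapTree = parentTree

heapTree-isTree : ∀ {n} → 0 < n → IsTree (heapTree n)
heapTree-isTree = parentTree-isTree

parent-◁ : ∀ a → a ≢ zero → ℕᵇ.toℕ (parent a) ◁ ℕᵇ.toℕ a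
parent-◁ zero     a≢0 = contradiction refl a≢0
parent-◁ 1+[2 b ] _   = cong (ℕᵇ.toℕ ∘ parent) (sym (ℕᵇ.fromℕ-toℕ 1+[2 b ]))
parent-◁ 2[1+ b ] _   = cong (ℕᵇ.toℕ ∘ parent) (sym (ℕᵇ.fromℕ-toℕ 2[1+ b ]))

stalk-◁-node : ∀ b → ℕᵇ.toℕ 1+[2 b ] ◁ ℕᵇ.toℕ 2[1+ b ]
stalk-◁-node b = parent-◁ 2[1+ b ] λ ()

node-◁-stalk : ∀ {e} → addressParent e ≡ just zero → ∀ b → ℕᵇ.toℕ 2[1+ b ] ◁ ℕᵇ.toℕ 1+[2 graft e b ]
node-◁-stalk {e} e-child b =
  subst (λ c → ℕᵇ.toℕ (maybe 2[1+_] zero c) ◁ ℕᵇ.toℕ 1+[2 graft e b ])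
    (addressParent-graft e-child b) (parent-◁ 1+[2 graft e b ] λ ())

-- Addresses are numbered level by level, and level s ends with the number 2^(s+1) - 2.
toℕ-<-2^size : ∀ b → 2 + ℕᵇ.toℕ b ≤ 2 ^ suc (size b)
toℕ-<-2^size zero     = ≤-refl
toℕ-<-2^size 1+[2 b ] = ≤-trans (n≤1+n _)
  (≤-trans (≤-reflexive (eq (ℕᵇ.toℕ b))) (*-monoʳ-≤ 2 (toℕ-<-2^size b)))
  where
  eq : ∀ t → suc (2 + suc (2 * t)) ≡ 2 * (2 + t)
  eq = solve-∀
toℕ-<-2^size 2[1+ b ] =
  ≤-trans (≤-reflexive (eq (ℕᵇ.toℕ b))) (*-monoʳ-≤ 2 (toℕ-<-2^size b))
  where
  eq : ∀ t → 2 + 2 * suc t ≡ 2 * (2 + t)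
  eq = solve-∀

-- Subsets of Fin n as labellings

-- Numbers outside the range read as absent, so that labellings are defined on all addresses.
at : ∀ {n} → Subset n → ℕ → Bool
at []      _       = false
at (b ∷ S) zero    = b
at (b ∷ S) (suc i) = at S i

∈⇒at : ∀ {n} {S : Subset n} {i} → i ∈ S → T (at S (Fin.toℕ i))
∈⇒at here       = tt
∈⇒at (there i∈) = ∈⇒at i∈

at⇒∈ : ∀ {n} (S : Subset n) i → T (at S i) → ∃[ j ] Fin.toℕ j ≡ i × j ∈ S
at⇒∈ (true ∷ S) zero    _ = zero , refl , here
at⇒∈ (_    ∷ S) (suc i) t = let j , eq , j∈ = at⇒∈ S i t in suc j , cong suc eq , there j∈

bit-at-─ : ∀ {n} (S C : Subset n) i → bit (at S i) ≤ bit (at (S ─ C) i) + bit (at C i)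
bit-at-─ []          []          i       = z≤n
bit-at-─ (false ∷ S) (_     ∷ C) zero    = z≤n
bit-at-─ (true  ∷ S) (true  ∷ C) zero    = ≤-refl
bit-at-─ (true  ∷ S) (false ∷ C) zero    = ≤-refl
bit-at-─ (_     ∷ S) (true  ∷ C) (suc i) = bit-at-─ S C i
bit-at-─ (_     ∷ S) (false ∷ C) (suc i) = bit-at-─ S C i

Σ< : ℕ → (ℕ → ℕ) → ℕ
Σ< zero    f = 0
Σ< (suc m) f = f 0 + Σ< m (f ∘ suc)

Σ<-cong : ∀ m {f g : ℕ → ℕ} → (∀ i → f i ≡ g i) → Σ< m f ≡ Σ< m g
Σ<-cong zero    f≗g = refl
Σ<-cong (suc m) f≗g = cong₂ _+_ (f≗g 0) (Σ<-cong m (f≗g ∘ suc))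

Σ<-split : ∀ m (f : ℕ → ℕ) →
  Σ< (m + m) (f ∘ suc) ≡ Σ< m (λ i → f (suc (2 * i))) + Σ< m (λ i → f (2 * suc i))
Σ<-split zero    f = refl
Σ<-split (suc m) f rewrite +-suc m m = begin
  f 1 + (f 2 + Σ< (m + m) (λ i → f (3 + i)))
    ≡⟨ cong (λ s → f 1 + (f 2 + s)) (Σ<-split m (λ i → f (2 + i))) ⟩
  f 1 + (f 2 + (Σ< m (λ i → f (3 + 2 * i)) + Σ< m (λ i → f (2 + 2 * suc i))))
    ≡⟨ cong₂ (λ s t → f 1 + (f 2 + (s + t)))
         (Σ<-cong m (λ i → cong (λ j → f (suc j)) (2+2* i)))
         (Σ<-cong m (λ i → cong f (2+2* (suc i)))) ⟩
  f 1 + (f 2 + (A + B))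
    ≡⟨ shuffle (f 1) (f 2) A B ⟩
  (f 1 + A) + (f 2 + B) ∎
  where
  open ≡-Reasoning
  A = Σ< m (λ i → f (suc (2 * suc i)))
  B = Σ< m (λ i → f (2 * suc (suc i)))
  2+2* : ∀ i → 2 + 2 * i ≡ 2 * suc i
  2+2* = solve-∀
  shuffle : ∀ a b c d → a + (b + (c + d)) ≡ (a + c) + (b + d)
  shuffle = solve-∀

addresses : ℕ → ℕ
addresses zero    = 1
addresses (suc d) = suc (addresses d + addresses d)

-- The left and right subtrees hold the odd and the positive even numbers, so the tree sum meets
-- each number below 2^(d+1) - 1 exactly once. Hence no cat is counted twice.
sum-toℕ : ∀ d (f : ℕ → ℕ) → sum d (f ∘ ℕᵇ.toℕ) ≡ Σ< (addresses d) f
sum-toℕ zero    f = sym (+-identityʳ (f 0))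
sum-toℕ (suc d) f = cong (f 0 +_) (trans
  (cong₂ _+_ (sum-toℕ d (λ i → f (suc (2 * i)))) (sum-toℕ d (λ i → f (2 * suc i))))
  (sym (Σ<-split (addresses d) f)))

Σ<-at-≤ : ∀ {n} m (C : Subset n) → Σ< m (bit ∘ at C) ≤ ∣ C ∣
Σ<-at-≤ zero    C           = z≤n
Σ<-at-≤ (suc m) []          = Σ<-at-≤ m []
Σ<-at-≤ (suc m) (true  ∷ C) = s≤s (Σ<-at-≤ m C)
Σ<-at-≤ (suc m) (false ∷ C) = Σ<-at-≤ m C

stalks nodes : ∀ {n} → Subset n → ℕᵇ → Bool
stalks S b = at S (ℕᵇ.toℕ 1+[2 b ])
nodes  S b = at S (ℕᵇ.toℕ 2[1+ b ])

sum-at-≤ : ∀ {n} d (C : Subset n) → sum d (bit ∘ at C ∘ ℕᵇ.toℕ) ≤ ∣ C ∣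
sum-at-≤ d C = ≤-trans (≤-reflexive (sum-toℕ d (bit ∘ at C))) (Σ<-at-≤ (addresses d) C)

-- Stalks and nodes are the left and right halves of the heap of all vertex numbers, which is one
-- level deeper.
sum-stalks-≤ : ∀ {n} d (C : Subset n) → sum d (bit ∘ stalks C) ≤ ∣ C ∣
sum-stalks-≤ d C = ≤-trans
  (≤-trans (m≤m+n _ _) (m≤n+m _ (bit (at C 0)))) (sum-at-≤ (suc d) C)

sum-nodes-≤ : ∀ {n} d (C : Subset n) → sum d (bit ∘ nodes C) ≤ ∣ C ∣
sum-nodes-≤ d C = ≤-trans
  (≤-trans (m≤n+m _ (sum d (bit ∘ stalks C))) (m≤n+m _ (bit (at C 0)))) (sum-at-≤ (suc d) C)

Φₙ-─ : ∀ {n} d (S C : Subset n) → Φₙ d (nodes S) ≤ Φₙ d (nodes (S ─ C)) + 2 * ∣ C ∣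
Φₙ-─ d S C = ≤-trans (Φₙ-loss d (bit ∘ nodes C) (λ b → bit-at-─ S C (ℕᵇ.toℕ 2[1+ b ])))
  (+-monoʳ-≤ (Φₙ d (nodes (S ─ C))) (*-monoʳ-≤ 2 (sum-nodes-≤ d C)))

Φₛ-─ : ∀ {n} d (S C : Subset n) → Φₛ d (stalks S) ≤ Φₛ d (stalks (S ─ C)) + 2 * ∣ C ∣
Φₛ-─ d S C = ≤-trans
  (≤-trans (m≤m+n _ _) (Φₛ-loss d (bit ∘ stalks C) (λ b → bit-at-─ S C (ℕᵇ.toℕ 1+[2 b ]))))
  (+-monoʳ-≤ (Φₛ d (stalks (S ─ C))) (*-monoʳ-≤ 2 (sum-stalks-≤ d C)))

-- Evasion on the heap tree

module _ {n d : ℕ} (2^[2+d]≤n : 2 ^ (2 + d) ≤ n) where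

  open Territory (heapTree n)

  node-< : ∀ b → size b ≤ d → ℕᵇ.toℕ 2[1+ b ] < n
  node-< b b≤d = begin-strict
    2 * suc (ℕᵇ.toℕ b)    <⟨ *-monoʳ-< 2 (toℕ-<-2^size b) ⟩
    2 * 2 ^ suc (size b)  ≤⟨ ^-monoʳ-≤ 2 (s≤s (s≤s b≤d)) ⟩
    2 ^ (2 + d)           ≤⟨ 2^[2+d]≤n ⟩
    n                     ∎
    where open ≤-Reasoning

  stalk-< : ∀ b → size b ≤ d → ℕᵇ.toℕ 1+[2 b ] < n
  stalk-< b b≤d = <-trans (◁⇒< _ _ (stalk-◁-node b)) (node-< b b≤d)

  at-neighbours : ∀ S {i j} → i ◁ j ⊎ j ◁ i → j < n → T (at S i) → T (at (neighbours S) j)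
  at-neighbours S {i} {j} i∼j j<n t with at⇒∈ S i t
  ... | i′ , refl , i∈ = subst (T ∘ at (neighbours S)) (Fin.toℕ-fromℕ< j<n)
    (∈⇒at (∈-neighbours⁺ i∈ (subst (λ j → Fin.toℕ i′ ◁ j ⊎ j ◁ Fin.toℕ i′) (sym (Fin.toℕ-fromℕ< j<n)) i∼j)))

  -- Vertices beyond depth `d` can be ignored, because both move conditions are one-sided
  -- implications.
  stalksToNodes : ∀ S → StalksToNodes d (stalks S) (nodes (neighbours S))
  stalksToNodes S = record
    { same  = λ b s → at-neighbours S (inj₁ (stalk-◁-node b)) (node-< b s)
    ; fromˡ = λ b s → at-neighbours S (inj₂ (node-◁-stalk {leftmost} refl b)) (node-< b s)
    ; fromʳ = λ b s → at-neighbours S (inj₂ (node-◁-stalk {rightmost} refl b)) (node-< b s)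
    }

  size-graft : ∀ {e} → size e ≡ 1 → ∀ b → size (graft e b) ≡ suc (size b)
  size-graft e1 zero     = e1
  size-graft e1 1+[2 b ] = cong suc (size-graft e1 b)
  size-graft e1 2[1+ b ] = cong suc (size-graft e1 b)

  nodesToStalks : ∀ S → NodesToStalks d (nodes S) (stalks (neighbours S))
  nodesToStalks S = record
    { same = λ b s → at-neighbours S (inj₂ (stalk-◁-node b)) (stalk-< b s)
    ; toˡ  = λ b s → at-neighbours S (inj₁ (node-◁-stalk {leftmost} refl b))
               (stalk-< _ (subst (_≤ d) (sym (size-graft refl b)) s))
    ; toʳ  = λ b s → at-neighbours S (inj₁ (node-◁-stalk {rightmost} refl b))
               (stalk-< _ (subst (_≤ d) (sym (size-graft refl b)) s))
    }

  at-⊤ : ∀ {i} → i < n → T (at {n} ⊤ i)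
  at-⊤ i<n = subst (T ∘ at {n} ⊤) (Fin.toℕ-fromℕ< i<n) (∈⇒at {S = ⊤ {n}} ∈⊤)

  -- The tree is bipartite, so it suffices to follow one side at a time: the invariant alternates
  -- between nodes and stalks, starting with all nodes.
  potential-evasion : ∀ {r M} → 0 < M → M ≤ full d →
    (∀ y → Φₛ d y ≤ M → M ≤ Φₛ d y + 2 * r → 2 * r ≤ ∂ d y) → ¬ CatWin (heapTree n) r
  potential-evasion {r} {M} 0<M M≤full boundary =
    survive r Safe nonempty step (inj₁ (≤-trans M≤full (Φₙ-full d (λ b s → at-⊤ (node-< b s)))))
    where
    Safe : Subset n → Set
    Safe S = M ≤ Φₙ d (nodes S) ⊎ M ≤ Φₛ d (stalks S)

    nonempty : ∀ {S} → Safe S → Nonempty S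
    nonempty {S} (inj₁ safe) = let b , t = Φₙ-support d (<-≤-trans 0<M safe)
                                   i , _ , i∈ = at⇒∈ S _ t in i , i∈
    nonempty {S} (inj₂ safe) = let b , t = Φₛ-support d (<-≤-trans 0<M safe)
                                   i , _ , i∈ = at⇒∈ S _ t in i , i∈

    -- Here `y` is the stalk set at the move, either reached by it or left by it. If its potential
    -- is below `M`, it is so by at most 2r, and then the mixed nodes repay what the cats took.
    regain : ∀ {a} y → M ≤ a + 2 * r → a ≤ Φₛ d y → ∀ {b} → Φₛ d y ≤ b → a + ∂ d y ≤ b → M ≤ b
    regain {a} y M≤ a≤ Φ≤b a+∂≤b with ≤-total M (Φₛ d y)
    ... | inj₁ M≤Φ = ≤-trans M≤Φ Φ≤b
    ... | inj₂ Φ≤M = ≤-trans M≤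
      (≤-trans (+-monoʳ-≤ a (boundary y Φ≤M (≤-trans M≤ (+-monoˡ-≤ (2 * r) a≤)))) a+∂≤b)

    step : ∀ {S C} → ∣ C ∣ ≤ r → Safe S → Safe (neighbours (S ─ C))
    step {S} {C} C≤r (inj₁ safe) =
      let gain = Φₙ+∂≤Φₛ d (nodesToStalks (S ─ C))
      in inj₂ (regain (stalks (neighbours (S ─ C)))
           (≤-trans safe (≤-trans (Φₙ-─ d S C) (+-monoʳ-≤ (Φₙ d (nodes (S ─ C))) (*-monoʳ-≤ 2 C≤r))))
           (m+n≤o⇒m≤o _ gain) ≤-refl gain)
    step {S} {C} C≤r (inj₂ safe) =
      let gain = Φₛ+∂≤Φₙ d (stalksToNodes (S ─ C))
      in inj₁ (regain (stalks (S ─ C))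
           (≤-trans safe (≤-trans (Φₛ-─ d S C) (+-monoʳ-≤ (Φₛ d (stalks (S ─ C))) (*-monoʳ-≤ 2 C≤r))))
           ≤-refl (m+n≤o⇒m≤o _ gain) gain)

-- The critical potential

module _ (k q : ℕ) where
  open Gauge (k + k) q

  M : ℕ
  M = heavy k * Q

  gauge-M : gauge M ≡ Q * k
  gauge-M = trans (gauge-* (heavy k)) (cong (Q *_) (weight-heavy k))

  gauge-0 : gauge 0 ≡ 0
  gauge-0 = trans (gauge-* 0) (trans (cong (Q *_) (weight-0 (k + k))) (*-zeroʳ Q))

  gauge-bit-full : ∀ d b → gauge (bit b * full d) ≤ K
  gauge-bit-full d false = ≤-trans (≤-reflexive gauge-0) z≤n
  gauge-bit-full d true  = begin
    gauge (full d + 0)                ≡⟨ cong gauge (+-identityʳ (full d)) ⟩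
    gauge (full d)                    ≡⟨ ∣-∣-identityʳ (gauge (full d)) ⟨
    ∣ gauge (full d) - 0 ∣            ≡⟨ cong (λ m → ∣ gauge (full d) - m ∣) gauge-0 ⟨
    gap (full d) 0                    ≤⟨ gap-full d 0 ⟩
    K                                 ∎
    where open ≤-Reasoning

  gauge-≤-+gap : ∀ m n → gauge m ≤ gauge n + gap m n
  gauge-≤-+gap m n = m≤n+∣m-n∣ (gauge m) (gauge n)

  -- The gauge is Qk at `M` and at most `K` at an empty or full tree. The way between them costs at
  -- most 2r to reach `Φₛ d y` and then `K` per mixed node. With fewer than 2r mixed nodes the total
  -- is at most 2rK + 2r = 2r(Q + 4), too little.
  boundary : ∀ d {r} → 2 * r * (Q + 4) < Q * k →
    ∀ y → Φₛ d y ≤ M → M ≤ Φₛ d y + 2 * r → 2 * r ≤ ∂ d y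
  boundary d {r} few y Φ≤M M≤ = ≮⇒≥ λ ∂<2r → <⇒≱ few (begin
    Q * k
      ≡⟨ gauge-M ⟨
    gauge M
      ≤⟨ gauge-≤-+gap M (Φₛ d y) ⟩
    gauge (Φₛ d y) + gap M (Φₛ d y)
      ≤⟨ +-mono-≤ (gauge-≤-+gap (Φₛ d y) (bit (y zero) * full d)) close ⟩
    gauge (bit (y zero) * full d) + gap (Φₛ d y) (bit (y zero) * full d) + 2 * r
      ≤⟨ +-monoˡ-≤ (2 * r) (+-mono-≤ (gauge-bit-full d (y zero)) (isoperimetry d y 0)) ⟩
    K + K * ∂ d y + 2 * r
      ≡⟨ cong (_+ 2 * r) (*-suc K (∂ d y)) ⟨
    K * suc (∂ d y) + 2 * r
      ≤⟨ +-monoˡ-≤ (2 * r) (*-monoʳ-≤ K ∂<2r) ⟩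
    K * (2 * r) + 2 * r
      ≡⟨ collect Q r ⟩
    2 * r * (Q + 4) ∎)
    where
    open ≤-Reasoning
    collect : ∀ q r → (q + 3) * (2 * r) + 2 * r ≡ 2 * r * (q + 4)
    collect = solve-∀
    close : gap M (Φₛ d y) ≤ 2 * r
    close = ≤-trans
      (subst (λ m → gap m (Φₛ d y) ≤ M ∸ Φₛ d y) (m+[n∸m]≡n Φ≤M) (gap-+ (M ∸ Φₛ d y) (Φₛ d y)))
      (m≤n+o⇒m∸n≤o M (Φₛ d y) M≤)

  1+3heavy : suc (3 * heavy k) ≡ 2 ^ (k + k)
  1+3heavy = go k
    where
    go : ∀ k → suc (3 * heavy k) ≡ 2 ^ (k + k)
    go zero    = refl
    go (suc k) = trans (eq (heavy k))
      (trans (cong (λ m → 2 * (2 * m)) (go k)) (cong (2 ^_) (cong suc (sym (+-suc k k)))))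
      where
      eq : ∀ u → suc (3 * suc (4 * u)) ≡ 2 * (2 * suc (3 * u))
      eq = solve-∀

  -- Three times `heavy k` is below 4^k, so `M` is at most 2^(2k+q), a third of 2 +
  -- `full (k + k + q)`. This fixes the depth.
  M≤full : M ≤ full (k + k + q)
  M≤full = +-cancelˡ-≤ 2 M (full (k + k + q)) (begin
    2 + M                          ≤⟨ +-mono-≤ (*-monoʳ-≤ 2 (m^n>0 2 (k + k + q))) M≤2^ ⟩
    2 * 2 ^ (k + k + q) + 2 ^ (k + k + q) ≡⟨ eq (2 ^ (k + k + q)) ⟩
    3 * 2 ^ (k + k + q)            ≡⟨ 2+full (k + k + q) ⟨
    2 + full (k + k + q)           ∎)
    where
    open ≤-Reasoning
    eq : ∀ a → 2 * a + a ≡ 3 * a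
    eq = solve-∀
    rearrange : ∀ u p → u * (3 * p) ≡ (3 * u) * p
    rearrange = solve-∀
    M≤2^ : M ≤ 2 ^ (k + k + q)
    M≤2^ = begin
      heavy k * (3 * 2 ^ q)        ≡⟨ rearrange (heavy k) (2 ^ q) ⟩
      3 * heavy k * 2 ^ q          ≤⟨ *-monoˡ-≤ (2 ^ q) (n≤1+n (3 * heavy k)) ⟩
      suc (3 * heavy k) * 2 ^ q    ≡⟨ cong (_* 2 ^ q) 1+3heavy ⟩
      2 ^ (k + k) * 2 ^ q          ≡⟨ ^-distribˡ-+-* 2 (k + k) q ⟨
      2 ^ (k + k + q)              ∎

  CatWin⇒≤ : ∀ {n r} → 2 ^ (2 + (k + k + q)) ≤ n → CatWin (heapTree n) r → Q * k ≤ 2 * r * (Q + 4)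
  CatWin⇒≤ {n} {r} large win = ≮⇒≥ λ few →
    potential-evasion {d = k + k + q} large {r} (0<M few) M≤full (boundary (k + k + q) {r} few) win
    where
    positive : ∀ k → 0 < Q * k → 0 < heavy k * Q
    -- For k = 0 the value `M` would be 0, but then the number of cats cannot be too small.
    positive zero    pos = contradiction (subst (0 <_) (*-zeroʳ Q) pos) λ ()
    positive (suc k) _   = <-≤-trans (>-nonZero⁻¹ Q) (m≤m+n Q _)
    0<M : 2 * r * (Q + 4) < Q * k → 0 < M
    0<M few = positive k (≤-<-trans z≤n few)

-- Logarithms and rationals

open import Data.Integer using (+_)

2^L≤n<2^[1+L] : ∀ n → 0 < n → ∃[ L ] 2 ^ L ≤ n × n < 2 ^ suc L
2^L≤n<2^[1+L] (suc zero)    _ = 0 , ≤-refl , ≤-refl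
2^L≤n<2^[1+L] (suc (suc n)) _ with 2^L≤n<2^[1+L] (suc n) (s≤s z≤n)
... | L , lower , upper with m≤n⇒m<n∨m≡n upper
...   | inj₁ below = L , m≤n⇒m≤1+n lower , below
...   | inj₂ at    = suc L , ≤-reflexive (sym at)
        , <-≤-trans (≤-reflexive (cong suc at)) (^-monoʳ-< 2 (s≤s (s≤s z≤n)) (n<1+n (suc L)))

-- Bounds every term of the sequence for log₂ n by the same integer `L`.
⌊log₂^⌋≤ : ∀ {n L} → n < 2 ^ L → ∀ K → ⌊log₂ n ^ K ⌋ ≤ L * K
⌊log₂^⌋≤ {n} {L} n< K = begin
  ⌊log₂ n ^ K ⌋        ≤⟨ ⌊log₂⌋-mono-≤ (^-monoˡ-≤ K (<⇒≤ n<)) ⟩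
  ⌊log₂ (2 ^ L) ^ K ⌋  ≡⟨ cong ⌊log₂_⌋ (^-*-assoc 2 L K) ⟩
  ⌊log₂ 2 ^ (L * K) ⌋  ≡⟨ ⌊log₂[2^n]⌋≡n (L * K) ⟩
  L * K                ∎
  where open ≤-Reasoning

1/[5+_]≤ : ∀ η → 0ℚ ℚ.< η → ∃[ m ] + 1 / (5 + m) ℚ.≤ η
1/[5+ mkℚ (+ zero)   d c ]≤ 0<η = contradiction 0<η λ { (ℚ.*<* (ℤ.+<+ ())) }
1/[5+ mkℚ ℤ.-[1+ _ ] d c ]≤ 0<η = contradiction 0<η λ { (ℚ.*<* ()) }
-- The denominator of η is 1 + d, so η ≥ 1 / (1 + d) ≥ 1 / (5 + d).
1/[5+ η@(mkℚ (+ suc a) d c) ]≤ _ = d , ℚ.toℚᵘ-cancel-≤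
  (ℚᵘ.≤-respˡ-≃ (ℚᵘ.≃-sym (ℚ.toℚᵘ-fromℚᵘ (ℚᵘ.mkℚᵘ (+ 1) (4 + d))))
    (ℚᵘ.*≤* (subst₂ ℤ._≤_ (ℤ.pos-* 1 (suc d)) (ℤ.pos-* (suc a) (5 + d))
      (ℤ.+≤+ (*-mono-≤ {1} {suc a} (s≤s z≤n) (m≤n+m (suc d) 4))))))

-- Since 1/4 - 1/(4 + m) = m / (4(4 + m)), this is the hypothesis after clearing denominators, with
-- the error term moved to the right.
quarter-≤ : ∀ m h ℓ k → m * ℓ ≤ 4 * (4 + m) * h * suc k →
  (+ 1 / 4) ℚ.* (+ ℓ / suc k) ℚ.≤ (+ h / 1) ℚ.+ (+ 1 / (4 + m)) ℚ.* (+ ℓ / suc k)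
quarter-≤ m h ℓ k bound = ℚ.toℚᵘ-cancel-≤
  (ℚᵘ.≤-respˡ-≃ (ℚᵘ.≃-sym (product 1 3))
    (ℚᵘ.≤-respʳ-≃ (ℚᵘ.≃-sym (ℚᵘ.≃-trans (ℚ.toℚᵘ-homo-+ (+ h / 1) _)
        (ℚᵘ.+-cong (ℚ.toℚᵘ-fromℚᵘ (ℚᵘ.mkℚᵘ (+ h) 0)) (product 1 (3 + m)))))
      (ℚᵘ.*≤* (subst₂ ℤ._≤_ lhs rhs (ℤ.+≤+ inℕ)))))
  where
  product : ∀ p a → ℚ.toℚᵘ ((+ p / suc a) ℚ.* (+ ℓ / suc k)) ℚᵘ.≃ ℚᵘ.mkℚᵘ (+ p) a ℚᵘ.* ℚᵘ.mkℚᵘ (+ ℓ) k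
  product p a = ℚᵘ.≃-trans (ℚ.toℚᵘ-homo-* (+ p / suc a) (+ ℓ / suc k))
    (ℚᵘ.*-cong (ℚ.toℚᵘ-fromℚᵘ (ℚᵘ.mkℚᵘ (+ p) a)) (ℚ.toℚᵘ-fromℚᵘ (ℚᵘ.mkℚᵘ (+ ℓ) k)))
  m′ = 4 + m
  K  = suc k
  lhs : + (1 * ℓ * (1 * (m′ * K))) ≡ + 1 ℤ.* + ℓ ℤ.* + (1 * (m′ * K))
  lhs = trans (ℤ.pos-* (1 * ℓ) _) (cong (ℤ._* + (1 * (m′ * K))) (ℤ.pos-* 1 ℓ))
  rhs : + ((h * (m′ * K) + 1 * ℓ * 1) * (4 * K)) ≡ (+ h ℤ.* + (m′ * K) ℤ.+ + 1 ℤ.* + ℓ ℤ.* + 1) ℤ.* + (4 * K)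
  rhs = trans (ℤ.pos-* (h * (m′ * K) + 1 * ℓ * 1) (4 * K)) (cong (ℤ._* + (4 * K))
    (trans (ℤ.pos-+ (h * (m′ * K)) _) (cong₂ ℤ._+_ (ℤ.pos-* h (m′ * K))
      (trans (ℤ.pos-* (1 * ℓ) 1) (cong (ℤ._* + 1) (ℤ.pos-* 1 ℓ))))))
  inℕ : 1 * ℓ * (1 * (m′ * K)) ≤ (h * (m′ * K) + 1 * ℓ * 1) * (4 * K)
  inℕ = begin
    1 * ℓ * (1 * (m′ * K))              ≡⟨ eqˡ m ℓ K ⟩
    K * (m * ℓ + 4 * ℓ)                 ≤⟨ *-monoʳ-≤ K (+-monoˡ-≤ (4 * ℓ) bound) ⟩
    K * (4 * m′ * h * K + 4 * ℓ)        ≡⟨ eqʳ m h ℓ K ⟩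
    (h * (m′ * K) + 1 * ℓ * 1) * (4 * K) ∎
    where
    open ≤-Reasoning
    eqˡ : ∀ m ℓ K → 1 * ℓ * (1 * ((4 + m) * K)) ≡ K * (m * ℓ + 4 * ℓ)
    eqˡ = solve-∀
    eqʳ : ∀ m h ℓ K → K * (4 * (4 + m) * h * K + 4 * ℓ) ≡ (h * ((4 + m) * K) + 1 * ℓ * 1) * (4 * K)
    eqʳ = solve-∀

scale-≤ : ∀ {a b e H Λ : ℚ} → 0ℚ ℚ.≤ Λ → b ℚ.≤ e → a ℚ.* Λ ℚ.≤ H ℚ.+ b ℚ.* Λ → (a ℚ.- e) ℚ.* Λ ℚ.≤ H
scale-≤ {a} {b} {e} {H} {Λ} 0≤Λ b≤e aΛ≤ = begin
  (a ℚ.- e) ℚ.* Λ                      ≡⟨ distribute a e Λ ⟩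
  a ℚ.* Λ ℚ.- e ℚ.* Λ                  ≤⟨ ℚ.+-monoˡ-≤ (ℚ.- (e ℚ.* Λ)) aΛ≤ ⟩
  H ℚ.+ b ℚ.* Λ ℚ.- e ℚ.* Λ            ≤⟨ ℚ.+-monoˡ-≤ (ℚ.- (e ℚ.* Λ)) (ℚ.+-monoʳ-≤ H
                                            (ℚ.*-monoʳ-≤-nonNeg Λ {{ℚ.nonNegative 0≤Λ}} b≤e)) ⟩
  H ℚ.+ e ℚ.* Λ ℚ.- e ℚ.* Λ            ≡⟨ cancel H (e ℚ.* Λ) ⟩
  H                                    ∎
  where
  open ℚ.≤-Reasoning
  open +-*-Solver
  distribute : ∀ a e Λ → (a ℚ.- e) ℚ.* Λ ≡ a ℚ.* Λ ℚ.- e ℚ.* Λ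
  distribute = solve 3 (λ a e Λ → (a :- e) :* Λ := a :* Λ :- e :* Λ) refl
  cancel : ∀ H x → H ℚ.+ x ℚ.- x ≡ H
  cancel = solve 2 (λ H x → H :+ x :- x := H) refl

-- Choice of the parameters

1+m≤2^m : ∀ m → suc m ≤ 2 ^ m
1+m≤2^m zero    = ≤-refl
1+m≤2^m (suc m) = begin
  2 + m          ≤⟨ s≤s (m≤n+m (suc m) m) ⟩
  suc m + suc m  ≡⟨ cong (_+_ (suc m)) (+-identityʳ (suc m)) ⟨
  2 * suc m      ≤⟨ *-monoʳ-≤ 2 (1+m≤2^m m) ⟩
  2 ^ suc m      ∎
  where open ≤-Reasoning

threshold : ℕ → ℕ
threshold m = m * (m + 4) + (m + 3)

-- First m(L + 1) ≤ 2(m + 1)k by the threshold. The bound on k then brings in the factor (m + 1)(Q +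
-- 4) / Q, which is at most m + 4 because 4(m + 1) ≤ 3Q.
asymptotics : ∀ m {k L h} → L ≤ k + k + (m + 3) → threshold m ≤ L →
  3 * 2 ^ m * k ≤ 2 * h * (3 * 2 ^ m + 4) → m * suc L ≤ 4 * (4 + m) * h
asymptotics m {k} {L} {h} L≤ large cats = *-cancelˡ-≤ Q (begin
  Q * (m * suc L)                         ≤⟨ *-monoʳ-≤ Q (*-monoʳ-≤ m (s≤s L≤)) ⟩
  Q * (m * suc (k + k + (m + 3)))         ≡⟨ eq₁ Q m k ⟩
  2 * m * (Q * k) + Q * (m * (m + 4))     ≤⟨ +-monoʳ-≤ (2 * m * (Q * k)) (*-monoʳ-≤ Q m[m+4]≤2k) ⟩
  2 * m * (Q * k) + Q * (k + k)           ≡⟨ eq₂ Q m k ⟩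
  2 * suc m * (Q * k)                     ≤⟨ *-monoʳ-≤ (2 * suc m) cats ⟩
  2 * suc m * (2 * h * (Q + 4))           ≡⟨ eq₃ Q m h ⟩
  4 * h * (m * Q + Q + 4 * suc m)         ≤⟨ *-monoʳ-≤ (4 * h) (+-monoʳ-≤ (m * Q + Q) 4[1+m]≤3Q) ⟩
  4 * h * (m * Q + Q + 3 * Q)             ≡⟨ eq₄ Q m h ⟩
  Q * (4 * (4 + m) * h)                   ∎)
  where
  open ≤-Reasoning
  Q = 3 * 2 ^ m
  instance
    Q≢0 : NonZero Q
    Q≢0 = m*n≢0 3 (2 ^ m) {{_}} {{m^n≢0 2 m}}
  m[m+4]≤2k : m * (m + 4) ≤ k + k
  m[m+4]≤2k = +-cancelʳ-≤ (m + 3) (m * (m + 4)) (k + k) (≤-trans large L≤)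
  4[1+m]≤3Q : 4 * suc m ≤ 3 * Q
  4[1+m]≤3Q = begin
    4 * suc m        ≤⟨ *-monoʳ-≤ 4 (1+m≤2^m m) ⟩
    4 * 2 ^ m        ≤⟨ *-monoˡ-≤ (2 ^ m) {4} {9} (m≤m+n 4 5) ⟩
    9 * 2 ^ m        ≡⟨ *-assoc 3 3 (2 ^ m) ⟩
    3 * Q            ∎
  eq₁ : ∀ Q m k → Q * (m * suc (k + k + (m + 3))) ≡ 2 * m * (Q * k) + Q * (m * (m + 4))
  eq₁ = solve-∀
  eq₂ : ∀ Q m k → 2 * m * (Q * k) + Q * (k + k) ≡ 2 * suc m * (Q * k)
  eq₂ = solve-∀
  eq₃ : ∀ Q m h → 2 * suc m * (2 * h * (Q + 4)) ≡ 4 * h * (m * Q + Q + 4 * suc m)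
  eq₃ = solve-∀
  eq₄ : ∀ Q m h → 4 * h * (m * Q + Q + 3 * Q) ≡ Q * (4 * (4 + m) * h)
  eq₄ = solve-∀

-- L - (m + 2) is rounded down to an even number 2k; the tree of depth 2k + m then fits, and at most
-- one level is lost to parity.
split-depth : ∀ m L → threshold m ≤ L → ∃[ k ] 2 + (k + k + m) ≤ L × L ≤ k + k + (m + 3)
split-depth m L large = go (L ∸ (m + 2)) (m∸n+n≡m (≤-trans m+2≤threshold large))
  where
  m+2≤threshold : m + 2 ≤ threshold m
  m+2≤threshold = ≤-trans (+-monoʳ-≤ m (n≤1+n 2)) (m≤n+m (m + 3) (m * (m + 4)))
  eq₁ : ∀ k m → 2 + (k + k + m) ≡ k + k + (m + 2)
  eq₁ = solve-∀
  eq₂ : ∀ k m → suc (2 + (k + k + m)) ≡ suc (k + k) + (m + 2)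
  eq₂ = solve-∀
  eq₃ : ∀ k m → suc (k + k) + (m + 2) ≡ k + k + (m + 3)
  eq₃ = solve-∀
  go : ∀ v → v + (m + 2) ≡ L → ∃[ k ] 2 + (k + k + m) ≤ L × L ≤ k + k + (m + 3)
  go v refl with halve v
  ... | even k = k , ≤-reflexive (eq₁ k m) , +-monoʳ-≤ (k + k) (+-monoʳ-≤ m (n≤1+n 2))
  ... | odd k  = k , ≤-trans (n≤1+n _) (≤-reflexive (eq₂ k m)) , ≤-reflexive (eq₃ k m)

catNumber-≥ : ∀ m {n L h} → 2 ^ L ≤ n → threshold m ≤ L → CatWin (heapTree n) h → m * suc L ≤ 4 * (4 + m) * h
catNumber-≥ m {n} {L} {h} 2^L≤n large win =
  let k , depth≤ , L≤ = split-depth m L large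
  in asymptotics m {k} {L} {h} L≤ large (CatWin⇒≤ k m (≤-trans (^-monoʳ-≤ 2 depth≤) 2^L≤n) win)

theorem1p5 : (ε : ℝ) → fromℚ 0ℚ <ᵣ ε →
    ∃[ n₀ ] ((n : ℕ) → n₀ ≤ n →
    Σ[ T ∈ Graph n ] (IsTree T ×
    (∃[ h ] (HasCatNumber T h ×
    ((fromℚ (+ 1 / 4) -ᵣ ε) *ᵣ log₂ n ≤ᵣ fromℕᵣ h)))))
theorem1p5 ε (η , 0<η , N , η≤ε) =
  let m′ , 1/[5+m′]≤η = 1/[5+ η ]≤ 0<η
      -- Makes 4 + m equal to 5 + m′, so that the error 1/(4 + m) is at most η.
      m = suc m′
  in 2 ^ threshold m , λ n n₀≤n →
    let 0<n = ≤-trans (m^n>0 2 (threshold m)) n₀≤n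
        L , 2^L≤n , n<2^[1+L] = 2^L≤n<2^[1+L] n 0<n
        h , catNumber-h@(win , _) = Territory.catNumber (heapTree n)
        m[1+L]≤ = catNumber-≥ m {L = L} {h = h} 2^L≤n
          (≮⇒≥ λ L< → <⇒≱ n<2^[1+L] (≤-trans (^-monoʳ-≤ 2 L<) n₀≤n)) win
    -- From index `N` on the terms of ε are at least η, and each term of the product is at most h.
    in heapTree n , heapTree-isTree 0<n , h , catNumber-h , λ δ 0<δ → N , λ k N≤k →
      let ℓ = ⌊log₂ n ^ suc k ⌋ in
      ℚ.≤-trans
        (scale-≤ {+ 1 / 4} {+ 1 / (4 + m)} {seq ε k} {+ h / 1} {log₂-seq n k}
          (ℚ.nonNegative⁻¹ _ {{ℚ.normalize-nonNeg ℓ (suc k)}})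
          (ℚ.≤-trans 1/[5+m′]≤η (ℚ.≤-trans (ℚ.≤-reflexive (sym (ℚ.+-identityˡ η))) (η≤ε k N≤k)))
          (quarter-≤ m h ℓ k (begin
            m * ℓ                        ≤⟨ *-monoʳ-≤ m (⌊log₂^⌋≤ {L = suc L} n<2^[1+L] (suc k)) ⟩
            m * (suc L * suc k)          ≡⟨ *-assoc m (suc L) (suc k) ⟨
            m * suc L * suc k            ≤⟨ *-monoˡ-≤ (suc k) m[1+L]≤ ⟩
            4 * (4 + m) * h * suc k      ∎)))
        (ℚ.≤-trans (ℚ.≤-reflexive (sym (ℚ.+-identityʳ (+ h / 1)))) (ℚ.+-monoʳ-≤ (+ h / 1) (ℚ.<⇒≤ 0<δ)))
  where open ≤-Reasoning
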